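{- The following $m$-equivalences hold: $\{121,1243\}\sim\{121,2143\}$, $\{112,1243\}\sim\{112,2143\}$ and $\{121,1234\}\sim\{121,2134\}$.
   Context: A (finite, reduced) multiset is $S=1^{a_1}2^{a_2}\cdots k^{a_k}$ with $k\ge 1$ and all $a_i\ge 1$, meaning that $i$ occurs with multiplicity $a_i$. A multipermutation of $S$ is a word having exactly $a_i$ occurrences of each letter $i\in[k]=\{1,\dots,k\}$ and no other letters. A word $\pi=\pi_1\cdots\pi_n$ contains a pattern (word) $\rho=\rho_1\cdots\rho_\ell$ if there are indices $i(1)<\cdots<i(\ell)$ such that for all $a,b\in[\ell]$: $\pi_{i(a)}<\pi_{i(b)}$ iff $\rho_a<\rho_b$, and $\pi_{i(a)}>\pi_{i(b)}$ iff $\rho_a>\rho_b$; otherwise $\pi$ avoids $\rho$. For a set $P$ of patterns, $\mathrm{av}(S;P)$ is the number of multipermutations of $S$ that avoid every pattern in $P$. Two sets of patterns $P,Q$ are $m$-equivalent, written here $P\sim Q$, if $\mathrm{av}(S;P)=\mathrm{av}(S;Q)$ for every multiset $S$. -}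

module Defs where

open import Data.Fin as Fin using (Fin; zero; suc; toℕ; fromℕ<)
open import Data.Fin.Properties as Finₚ using (any?; all?; toℕ-fromℕ<; toℕ-injective)
open import Data.List using (List; []; _∷_; length; lookup; filter; map; upTo; tabulate; cartesianProductWith)
open import Data.List.Membership.Propositional using (_∈_)
open import Data.List.Membership.Propositional.Properties
  using (∈-map⁺; ∈-upTo⁺; ∈-cartesianProductWith⁺; ∈-filter⁺; ∈-filter⁻)
open import Data.List.Properties using (∷-injective; filter-accept; filter-reject; tabulate-cong)
open import Data.List.Relation.Unary.All as All using (All; []; _∷_)
import Data.List.Relation.Unary.AllPairs as AllPairs
open import Data.List.Relation.Unary.Any using (here)
open import Data.List.Relation.Unary.Unique.Propositional using (Unique)
import Data.List.Relation.Unary.Unique.Propositional.Properties as Uniqueₚ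
open import Data.Nat using (ℕ; zero; suc; _+_; _≤_; _<_; _>_; _≟_; _≤?_; _<?_; s≤s; z≤n)
open import Data.Nat.ListAction using (sum)
open import Data.Nat.Properties using (suc-injective; +-suc)
open import Data.Product using (∃; _×_; _,_; proj₂)
open import Data.Vec as Vec using (Vec; []; _∷_)
open import Function using (_∘_; _⇔_; mk⇔; Equivalence)
open import Relation.Binary.PropositionalEquality using (_≡_; _≢_; refl; sym; trans; cong; cong₂; subst)
open import Relation.Nullary using (¬_; Dec; yes; no)
open import Relation.Nullary.Decidable using (map′; ¬?; _×-dec_; _→-dec_)
open import Relation.Unary using (Decidable)

Word : Set
Word = List ℕ

record Multiset : Set where
  field
    k      : ℕ
    k≥1    : 1 ≤ k
    mult   : Fin k → ℕ
    mult≥1 : ∀ i → 1 ≤ mult i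

-- Fin k is 0-based while the letters of a multiset are 1, …, k:
-- mult i is the multiplicity of letter i.
letter : ∀ {k} → Fin k → ℕ
letter i = suc (toℕ i)

occurrences : ℕ → Word → ℕ
occurrences x w = length (filter (x ≟_) w)

IsMultipermutation : Multiset → Word → Set
IsMultipermutation S w =
  (∀ i → occurrences (letter i) w ≡ mult i) × All (λ x → 1 ≤ x × x ≤ k) w
  where open Multiset S

Increasing : ∀ {n ℓ} → Vec (Fin n) ℓ → Set
Increasing i = ∀ a b → a Fin.< b → Vec.lookup i a Fin.< Vec.lookup i b

OrderIsomorphicAt : (π ρ : Word) → Vec (Fin (length π)) (length ρ) → Set
OrderIsomorphicAt π ρ i = ∀ a b →
    (lookup π (Vec.lookup i a) < lookup π (Vec.lookup i b) ⇔ lookup ρ a < lookup ρ b)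
  × (lookup π (Vec.lookup i a) > lookup π (Vec.lookup i b) ⇔ lookup ρ a > lookup ρ b)

Contains : (π ρ : Word) → Set
Contains π ρ = ∃ λ (i : Vec (Fin (length π)) (length ρ)) → Increasing i × OrderIsomorphicAt π ρ i

Avoids : (π ρ : Word) → Set
Avoids π ρ = ¬ Contains π ρ

-- A finite set of patterns is given by a list; order and repetition do not matter.
AvoidsAll : List Word → Word → Set
AvoidsAll P π = All (Avoids π) P

isMultipermutation? : ∀ S → Decidable (IsMultipermutation S)
isMultipermutation? S w =
  all? (λ i → occurrences (letter i) w ≟ mult i)
    ×-dec All.all? (λ x → (1 ≤? x) ×-dec (x ≤? k)) w
  where open Multiset S

_⇔-dec_ : ∀ {A B : Set} → Dec A → Dec B → Dec (A ⇔ B)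
a? ⇔-dec b? = map′ (λ (f , g) → mk⇔ f g) (λ e → Equivalence.to e , Equivalence.from e)
                   ((a? →-dec b?) ×-dec (b? →-dec a?))

anyVec? : ∀ {n ℓ} {P : Vec (Fin n) ℓ → Set} → Decidable P → Dec (∃ P)
anyVec? {ℓ = zero}  P? = map′ ([] ,_) (λ { ([] , p) → p }) (P? [])
anyVec? {ℓ = suc ℓ} P? =
  map′ (λ (x , xs , p) → x ∷ xs , p) (λ { (x ∷ xs , p) → x , xs , p })
       (any? λ x → anyVec? λ xs → P? (x ∷ xs))

increasing? : ∀ {n ℓ} → Decidable (Increasing {n} {ℓ})
increasing? i = all? λ a → all? λ b →
  (a Finₚ.<? b) →-dec (Vec.lookup i a Finₚ.<? Vec.lookup i b)

orderIsomorphicAt? : ∀ π ρ → Decidable (OrderIsomorphicAt π ρ)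
orderIsomorphicAt? π ρ i = all? λ a → all? λ b →
  ((_ <? _) ⇔-dec (_ <? _)) ×-dec ((_ <? _) ⇔-dec (_ <? _))

contains? : ∀ π ρ → Dec (Contains π ρ)
contains? π ρ = anyVec? λ i → increasing? i ×-dec orderIsomorphicAt? π ρ i

avoidsAll? : ∀ P → Decidable (AvoidsAll P)
avoidsAll? P π = All.all? (λ ρ → ¬? (contains? π ρ)) P

words : List ℕ → ℕ → List Word
words A zero    = [] ∷ []
words A (suc n) = cartesianProductWith _∷_ A (words A n)

-- That this lists every multipermutation exactly once is
-- multipermutations-complete, multipermutations-sound and
-- multipermutations-unique below.
multipermutations : Multiset → List Word
multipermutations S =
  filter (isMultipermutation? S) (words (map suc (upTo k)) (sum (tabulate mult)))
  where open Multiset S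

av : Multiset → List Word → ℕ
av S P = length (filter (avoidsAll? P) (multipermutations S))

infix 4 _∼_

_∼_ : List Word → List Word → Set
P ∼ Q = ∀ S → av S P ≡ av S Q

private
  sum-bump : ∀ {k} (j : Fin k) (f g : Fin k → ℕ) →
             (∀ i → i ≢ j → f i ≡ g i) → f j ≡ suc (g j) →
             sum (tabulate f) ≡ suc (sum (tabulate g))
  sum-bump zero    f g same up =
    cong₂ _+_ up (cong sum (tabulate-cong λ i → same (suc i) λ ()))
  sum-bump (suc j) f g same up =
    trans (cong₂ _+_ (same zero λ ())
                     (sum-bump j (f ∘ suc) (g ∘ suc) (λ i i≢j → same (suc i) (i≢j ∘ Finₚ.suc-injective)) up))
          (+-suc (g zero) _)

  sum-zero : ∀ k → sum (tabulate {n = k} λ _ → 0) ≡ 0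
  sum-zero zero    = refl
  sum-zero (suc k) = sum-zero k

  sum-occurrences : ∀ k {w} → All (λ x → 1 ≤ x × x ≤ k) w →
                    sum (tabulate {n = k} λ i → occurrences (letter i) w) ≡ length w
  sum-occurrences k [] = sum-zero k
  sum-occurrences k {suc x ∷ w} ((_ , x<k) ∷ ps) =
    trans (sum-bump j _ _
            (λ i i≢j → cong length (filter-reject (letter i ≟_) λ e →
               i≢j (toℕ-injective (trans (suc-injective e) (sym (toℕ-fromℕ< x<k))))))
            (cong length (filter-accept (letter j ≟_) (cong suc (toℕ-fromℕ< x<k)))))
          (cong suc (sum-occurrences k ps))
    where j = fromℕ< x<k

  ∈-words : ∀ k {w} → All (λ x → 1 ≤ x × x ≤ k) w → w ∈ words (map suc (upTo k)) (length w)
  ∈-words k [] = here refl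
  ∈-words k {suc x ∷ w} ((_ , x<k) ∷ ps) =
    ∈-cartesianProductWith⁺ _∷_ (∈-map⁺ suc (∈-upTo⁺ x<k)) (∈-words k ps)

  words-unique : ∀ {A} → Unique A → ∀ n → Unique (words A n)
  words-unique u zero    = [] AllPairs.∷ AllPairs.[]
  words-unique u (suc n) = Uniqueₚ.cartesianProductWith⁺ _∷_ ∷-injective u (words-unique u n)

multipermutations-complete : ∀ S {w} → IsMultipermutation S w → w ∈ multipermutations S
multipermutations-complete S {w} p@(occ , ps) =
  ∈-filter⁺ (isMultipermutation? S)
    (subst (λ n → w ∈ words (map suc (upTo k)) n)
           (trans (sym (sum-occurrences k ps)) (cong sum (tabulate-cong occ)))
           (∈-words k ps))
    p
  where open Multiset S

multipermutations-sound : ∀ S {w} → w ∈ multipermutations S → IsMultipermutation S w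
multipermutations-sound S w∈ =
  proj₂ (∈-filter⁻ (isMultipermutation? S) {xs = words (map suc (upTo k)) (sum (tabulate mult))} w∈)
  where open Multiset S

multipermutations-unique : ∀ S → Unique (multipermutations S)
multipermutations-unique S =
  Uniqueₚ.filter⁺ (isMultipermutation? S)
    (words-unique (Uniqueₚ.map⁺ suc-injective (Uniqueₚ.upTo⁺ k)) (sum (tabulate mult)))
  where open Multiset S

-- Build the words from the largest letter down. A word avoiding 121 (resp. 112) with least letter i is
-- u i⋯i v (resp. u i v i⋯i) for a split u v of the word of its larger letters. The split is admissible for 12⊕σ
-- if v avoids 1⊕σ, and for 21⊕σ if no letter of u is the 1 of a copy of 1⊕σ whose σ lies in v. Let the state of
-- a word be (p , q), with p the number of admissible splits and q the number of splits whose right part avoids σ;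
-- the latter are always admissible. In both cases an insertion at a split with v avoiding σ adds to p the
-- multiplicity of i, while the p − q remaining splits yield p − q consecutive values of the new p, the same in
-- both cases: for 12⊕σ an insertion destroys the admissible splits to its left, for 21⊕σ those to its right with
-- right part containing σ. The new q does not depend on the case, so the two generating trees have equal levels.
module Submission where

open import Defs
open import Data.Bool using (true; false)
open import Data.Fin as Fin using (Fin; zero; suc; toℕ)
open import Data.Fin.Patterns using (0F; 1F; 2F; 3F)
open import Data.Fin.Properties as Finₚ using (all?)
open import Data.List using (List; []; _∷_; _++_; [_]; concatMap; downFrom; drop; filter; length; lookup; map; replicate; tabulate)
open import Data.List.Membership.Propositional using (_∈_; find; lose)
open import Data.List.Membership.Propositional.Properties
  using (∈-++⁺ʳ; ∈-map⁺; ∈-map⁻; ∈-filter⁺; ∈-filter⁻; ∈-concatMap⁺; ∈-concatMap⁻)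
open import Data.List.Membership.Propositional.Properties.WithK using (unique∧set⇒bag)
open import Data.List.Properties
  using (∷-injectiveˡ; ∷-injectiveʳ; ++-assoc; ++-cancelˡ; ++-identityʳ; concatMap-map; filter-++; filter-accept;
         filter-all; filter-none; filter-reject; length-++; length-downFrom; length-filter; length-map;
         length-replicate; map-++; map-concatMap; map-cong; map-cong-local; map-id; map-∘)
open import Data.List.Relation.Binary.BagAndSetEquality using (∼bag⇒↭)
open import Data.List.Relation.Binary.Permutation.Propositional as Perm
  using (_↭_; ↭-refl; ↭-reflexive; ↭-sym; ↭-trans)
import Data.List.Relation.Binary.Permutation.Propositional.Properties as Permₚ
open import Data.List.Relation.Binary.Sublist.Propositional
  using (_⊆_; []; _∷_; _∷ʳ_; from∈; minimum; to∈; ⊆-refl; ⊆-reflexive; ⊆-trans)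
open import Data.List.Relation.Binary.Sublist.Propositional.Properties
  using (All-resp-⊆; drop-⊆; drop⁺-≥; filter-⊆; filter⁺; ++⁺; ++⁺ʳ; ++⁺ˡ; ∷ˡ⁻)
open import Data.List.Relation.Unary.All as All using (All; []; _∷_)
import Data.List.Relation.Unary.All.Properties as Allₚ
open import Data.List.Relation.Unary.AllPairs using ([]; _∷_)
open import Data.List.Relation.Unary.Any using (here; there)
open import Data.List.Relation.Unary.Unique.Propositional using (Unique)
import Data.List.Relation.Unary.Unique.Propositional.Properties as Uniqueₚ
open import Data.Nat
  using (ℕ; zero; suc; pred; _+_; _<_; _≤_; _≥_; _<?_; _≤?_; _≥?_; _≟_; s≤s; s<s; s<s⁻¹; z<s)
open import Data.Nat.Properties
  using (+-assoc; +-comm; +-identityʳ; +-suc; <-asym; <-cmp; <-irrefl; <-trans; <-≤-trans; <⇒≤; <⇒≢; <⇒≱; m<m+n;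
         m≤m+n; m≤n+m; m≤n⇒m<n∨m≡n; suc-injective; ≤-<-trans; ≤-antisym; ≤-pred; ≤-refl; ≤-reflexive; ≤-trans;
         ≤∧≢⇒<; ≤⇒≯; ≮⇒≥)
open import Data.Product using (Σ; ∃; ∃₂; _×_; _,_; map₁; proj₁; proj₂)
open import Data.Sum using (_⊎_; inj₁; inj₂)
open import Data.Vec as Vec using (Vec; []; _∷_)
open import Data.Vec.Properties using (lookup-map; lookup∘tabulate; tabulate-cong; tabulate∘lookup)
open import Function using (_∘_; _⇔_; case_of_; mk⇔; Equivalence)
open import Relation.Binary.Definitions using (tri<; tri≈; tri>)
open import Relation.Binary.PropositionalEquality
  using (_≡_; _≢_; refl; sym; trans; cong; cong₂; subst; subst₂; module ≡-Reasoning)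
open import Relation.Nullary using (¬_; Dec; yes; no; contradiction; does)
open import Relation.Nullary.Decidable using (True; map′; toWitness; _×-dec_; _→-dec_)
open import Relation.Unary using (Decidable)

-- No bijection of words is written down. Instead the admissible splits of a word are numbered by
-- ranks 0, ..., p - 1, and the state of a child depends only on a, (p , q) and the rank, where 1 +
-- a is the multiplicity of the new letter i. Right parts avoiding σ are the shortest ones, so their
-- lengths 0, ..., q - 1 serve as ranks in both cases; this is why q belongs to the state and why
-- the new q can be read off from it. If v contains σ and the split has rank r, the new p is r + 1 +
-- e. Here e = 0 for 121, where the further copies of i stand before v and hence before σ, and e = a
-- for 112, where they stand at the end with nothing larger behind. For 12⊕σ admissibility passes to
-- shorter right parts, so r is the length of v. For 21⊕σ it does not: moving the cut to the right
-- adds letters on the left that may serve as the 2. There the admissible splits with σ in v are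
-- counted from the left, starting at q. Those to the left survive because the test of a letter j
-- ignores all letters up to j, and i < j; to the right, i is the strictest letter and any remaining
-- σ closes the split.

private variable
  A B : Set
  a b c i j ℓ m : ℕ
  u v w τ : Word
  as : List ℕ

-- Pattern containment by sublists

lookup∷drop : ∀ (w : Word) x → lookup w x ∷ drop (suc (toℕ x)) w ≡ drop (toℕ x) w
lookup∷drop (_ ∷ _) zero    = refl
lookup∷drop (_ ∷ w) (suc x) = lookup∷drop w x

increasing⇒⊆ : ∀ (w : Word) (i : Vec (Fin (length w)) ℓ) → Increasing i →
               Vec.toList (Vec.map (lookup w) i) ⊆ w
increasing⇒⊆ w []       _   = minimum w
increasing⇒⊆ w (x ∷ xs) inc = ⊆-trans (go x xs inc) (drop-⊆ (toℕ x) w)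
  where
  -- The next position must lie behind x, so the induction tracks the suffix of `w` starting at x
  -- instead of `w` itself.
  go : ∀ {ℓ} x (xs : Vec (Fin (length w)) ℓ) → Increasing (x ∷ xs) →
       lookup w x ∷ Vec.toList (Vec.map (lookup w) xs) ⊆ drop (toℕ x) w
  go x []       _   = ⊆-trans (refl ∷ minimum _) (⊆-reflexive (lookup∷drop w x))
  go x (y ∷ ys) inc = ⊆-trans
    (refl ∷ ⊆-trans (go y ys (λ a b a<b → inc (suc a) (suc b) (s<s a<b)))
                    (drop⁺-≥ {xs = w} (inc zero (suc zero) z<s)))
    (⊆-reflexive (lookup∷drop w x))

⊆⇒increasing : ∀ (w : Word) (τ : Vec ℕ ℓ) → Vec.toList τ ⊆ w →
               Σ (Vec (Fin (length w)) ℓ) λ i → Increasing i × (∀ a → lookup w (Vec.lookup i a) ≡ Vec.lookup τ a)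
⊆⇒increasing w [] _ = [] , (λ ()) , λ ()
⊆⇒increasing (x ∷ w) τ@(_ ∷ _) (.x ∷ʳ p) with i , inc , eq ← ⊆⇒increasing w τ p =
  Vec.map suc i ,
  (λ a b a<b → subst₂ Fin._<_ (sym (lookup-map a suc i)) (sym (lookup-map b suc i)) (s<s (inc a b a<b))) ,
  λ a → trans (cong (lookup (x ∷ w)) (lookup-map a suc i)) (eq a)
⊆⇒increasing (x ∷ w) (.x ∷ τ) (refl ∷ p) with i , inc , eq ← ⊆⇒increasing w τ p =
  zero ∷ Vec.map suc i , inc′ , λ where
    zero    → refl
    (suc a) → trans (cong (lookup (x ∷ w)) (lookup-map a suc i)) (eq a)
  where
  inc′ : Increasing (zero ∷ Vec.map suc i)
  inc′ zero    (suc b) _   = subst (λ x → 0 < toℕ x) (sym (lookup-map b suc i)) z<s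
  inc′ (suc a) (suc b) a<b =
    subst₂ Fin._<_ (sym (lookup-map a suc i)) (sym (lookup-map b suc i)) (s<s (inc a b (s<s⁻¹ a<b)))

-- The letters of ρ are exactly 1, …, m; unrank picks a position for each of them.
record Standard (m : ℕ) (ρ : Word) : Set where
  field
    rank        : Fin (length ρ) → Fin m
    unrank      : Fin m → Fin (length ρ)
    ranked      : ∀ a → lookup ρ a ≡ letter (rank a)
    rank∘unrank : ∀ x → rank (unrank x) ≡ x

Monotone : (Fin m → ℕ) → Set
Monotone c = ∀ x y → x Fin.< y → c x < c y

module _ {ρ : Word} (std : Standard m ρ) where
  open Standard std

  Occurrence : Word → (Fin m → ℕ) → Set
  Occurrence w c = Vec.toList (Vec.tabulate (c ∘ rank)) ⊆ w

  private
    module _ {c : Fin m → ℕ} (mono : Monotone c) where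
      reflects : ∀ {x y} → c x < c y → x Fin.< y
      reflects {x} {y} cx<cy with Finₚ.<-cmp x y
      ... | tri< x<y _    _   = x<y
      ... | tri≈ _   refl _   = contradiction cx<cy (<-irrefl refl)
      ... | tri> _   _    y<x = contradiction (mono y x y<x) (<-asym cx<cy)

      embeds : ∀ {x y} {i j p q : ℕ} → i ≡ c x → j ≡ c y → p ≡ letter x → q ≡ letter y → (i < j) ⇔ (p < q)
      embeds refl refl refl refl = mk⇔ (s<s ∘ reflects) (mono _ _ ∘ s<s⁻¹)

    unrank-lookup : ∀ x → lookup ρ (unrank x) ≡ letter x
    unrank-lookup x = trans (ranked (unrank x)) (cong letter (rank∘unrank x))

  occurrence⇒contains : ∀ {w c} → Monotone c → Occurrence w c → Contains w ρ
  occurrence⇒contains {w} {c} mono occ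
    with i , inc , eq ← ⊆⇒increasing w (Vec.tabulate (c ∘ rank)) occ =
    i , inc , λ a b → embeds mono (at a) (at b) (ranked a) (ranked b)
                    , embeds mono (at b) (at a) (ranked b) (ranked a)
    where
    at : ∀ a → lookup w (Vec.lookup i a) ≡ c (rank a)
    at a = trans (eq a) (lookup∘tabulate (c ∘ rank) a)

  contains⇒occurrence : ∀ {w} → Contains w ρ → ∃ λ c → Monotone c × Occurrence w c
  contains⇒occurrence {w} (i , inc , iso) =
    val ∘ unrank , mono , subst (λ v → Vec.toList v ⊆ w) val-vec (increasing⇒⊆ w i inc)
    where
    val : Fin (length ρ) → ℕ
    val a = lookup w (Vec.lookup i a)

    mono : Monotone (val ∘ unrank)
    mono x y x<y = Equivalence.from (proj₁ (iso (unrank x) (unrank y)))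
      (subst₂ _<_ (sym (unrank-lookup x)) (sym (unrank-lookup y)) (s<s x<y))

    -- Order isomorphism speaks only of strict inequalities; equality follows by excluding both.
    -- Hence one value per letter of ρ, read off at `unrank`, describes the whole occurrence.
    val-equal : ∀ a b → lookup ρ a ≡ lookup ρ b → val a ≡ val b
    val-equal a b eq with <-cmp (val a) (val b)
    ... | tri< lt _ _ = contradiction (Equivalence.to (proj₁ (iso a b)) lt) (<-irrefl eq)
    ... | tri≈ _ e  _ = e
    ... | tri> _ _ gt = contradiction (Equivalence.to (proj₂ (iso a b)) gt) (<-irrefl (sym eq))

    val-vec : Vec.map (lookup w) i ≡ Vec.tabulate (val ∘ unrank ∘ rank)
    val-vec = trans (sym (tabulate∘lookup _)) (tabulate-cong λ a →
      trans (lookup-map a (lookup w) i)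
            (val-equal a (unrank (rank a)) (trans (ranked a) (sym (unrank-lookup (rank a))))))

mono-∷ : ∀ {x y} {v : Vec ℕ m} → x < y → Monotone (Vec.lookup (y ∷ v)) → Monotone (Vec.lookup (x ∷ y ∷ v))
mono-∷ x<y mono zero    (suc zero)    _   = x<y
mono-∷ x<y mono zero    (suc (suc j)) _   = <-trans x<y (mono zero (suc j) z<s)
mono-∷ x<y mono (suc i) (suc j)       i<j = mono i j (s<s⁻¹ i<j)

mono-[_] : ∀ x → Monotone (Vec.lookup (x ∷ []))
mono-[ x ] zero zero ()

module _ (m : ℕ) (ρ : Word) (rk : Vec (Fin m) (length ρ)) (unrk : Vec (Fin (length ρ)) m)
         {r : True (all? λ a → lookup ρ a ≟ letter (Vec.lookup rk a))}
         {s : True (all? λ x → Vec.lookup rk (Vec.lookup unrk x) Finₚ.≟ x)} where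
  standard : Standard m ρ
  standard = record { rank = Vec.lookup rk ; unrank = Vec.lookup unrk
                    ; ranked = toWitness r ; rank∘unrank = toWitness s }

std121 : Standard 2 (1 ∷ 2 ∷ 1 ∷ [])
std121 = standard 2 _ (0F ∷ 1F ∷ 0F ∷ []) (0F ∷ 1F ∷ [])

std112 : Standard 2 (1 ∷ 1 ∷ 2 ∷ [])
std112 = standard 2 _ (0F ∷ 0F ∷ 1F ∷ []) (0F ∷ 2F ∷ [])

std1243 : Standard 4 (1 ∷ 2 ∷ 4 ∷ 3 ∷ [])
std1243 = standard 4 _ (0F ∷ 1F ∷ 3F ∷ 2F ∷ []) (0F ∷ 1F ∷ 3F ∷ 2F ∷ [])

std2143 : Standard 4 (2 ∷ 1 ∷ 4 ∷ 3 ∷ [])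
std2143 = standard 4 _ (1F ∷ 0F ∷ 3F ∷ 2F ∷ []) (1F ∷ 0F ∷ 3F ∷ 2F ∷ [])

std1234 : Standard 4 (1 ∷ 2 ∷ 3 ∷ 4 ∷ [])
std1234 = standard 4 _ (0F ∷ 1F ∷ 2F ∷ 3F ∷ []) (0F ∷ 1F ∷ 2F ∷ 3F ∷ [])

std2134 : Standard 4 (2 ∷ 1 ∷ 3 ∷ 4 ∷ [])
std2134 = standard 4 _ (1F ∷ 0F ∷ 2F ∷ 3F ∷ []) (1F ∷ 0F ∷ 2F ∷ 3F ∷ [])

-- Avoidance of the six patterns as inequalities between letters

Avoids121 Avoids112 : Word → Set
Avoids121 w = ∀ {x y} → x < y → ¬ x ∷ y ∷ x ∷ [] ⊆ w
Avoids112 w = ∀ {x y} → x < y → ¬ x ∷ x ∷ y ∷ [] ⊆ w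

Rel : Set₁
Rel = ℕ → ℕ → Set

-- Here σ is the pattern of the two-letter words outside S: 21 if S is _≤_, and 12 if S is _≥_.
Avoids12⊕ Avoids21⊕ : Rel → Word → Set
Avoids12⊕ S w = ∀ {a b c d} → a < b → b < c → b < d → a ∷ b ∷ c ∷ d ∷ [] ⊆ w → S c d
Avoids21⊕ S w = ∀ {a b c d} → a < b → b < c → b < d → b ∷ a ∷ c ∷ d ∷ [] ⊆ w → S c d

avoids121⇔ : ∀ w → Avoids w (1 ∷ 2 ∷ 1 ∷ []) ⇔ Avoids121 w
avoids121⇔ w = mk⇔
  (λ av {x} {y} x<y occ → av (occurrence⇒contains std121 {c = Vec.lookup (x ∷ y ∷ [])} (mono-∷ x<y mono-[ _ ]) occ))
  (λ av con → let c , mono , occ = contains⇒occurrence std121 con in av (mono 0F 1F z<s) occ)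

avoids112⇔ : ∀ w → Avoids w (1 ∷ 1 ∷ 2 ∷ []) ⇔ Avoids112 w
avoids112⇔ w = mk⇔
  (λ av {x} {y} x<y occ → av (occurrence⇒contains std112 {c = Vec.lookup (x ∷ y ∷ [])} (mono-∷ x<y mono-[ _ ]) occ))
  (λ av con → let c , mono , occ = contains⇒occurrence std112 con in av (mono 0F 1F z<s) occ)

mono₄ : ∀ {a b c d} → a < b → b < c → c < d → Monotone (Vec.lookup (a ∷ b ∷ c ∷ d ∷ []))
mono₄ a<b b<c c<d = mono-∷ a<b (mono-∷ b<c (mono-∷ c<d mono-[ _ ]))

2F<3F : Fin._<_ {4} {4} 2F 3F
2F<3F = s<s (s<s z<s)

avoids1243⇔ : ∀ w → Avoids w (1 ∷ 2 ∷ 4 ∷ 3 ∷ []) ⇔ Avoids12⊕ _≤_ w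
avoids1243⇔ w = mk⇔
  -- The third letter of 1243 is its largest, so the increasing list of values is a, b, d, c.
  (λ av {_} {_} {_} {_} a<b b<c b<d occ → ≮⇒≥ λ d<c → av (occurrence⇒contains std1243 (mono₄ a<b b<d d<c) occ))
  (λ av con → let c , mono , occ = contains⇒occurrence std1243 con in
    <⇒≱ (mono 2F 3F 2F<3F) (av (mono 0F 1F z<s) (mono 1F 3F (s<s z<s)) (mono 1F 2F (s<s z<s)) occ))

avoids2143⇔ : ∀ w → Avoids w (2 ∷ 1 ∷ 4 ∷ 3 ∷ []) ⇔ Avoids21⊕ _≤_ w
avoids2143⇔ w = mk⇔
  (λ av {_} {_} {_} {_} a<b b<c b<d occ → ≮⇒≥ λ d<c → av (occurrence⇒contains std2143 (mono₄ a<b b<d d<c) occ))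
  (λ av con → let c , mono , occ = contains⇒occurrence std2143 con in
    <⇒≱ (mono 2F 3F 2F<3F) (av (mono 0F 1F z<s) (mono 1F 3F (s<s z<s)) (mono 1F 2F (s<s z<s)) occ))

avoids1234⇔ : ∀ w → Avoids w (1 ∷ 2 ∷ 3 ∷ 4 ∷ []) ⇔ Avoids12⊕ _≥_ w
avoids1234⇔ w = mk⇔
  (λ av {_} {_} {_} {_} a<b b<c b<d occ → ≮⇒≥ λ c<d → av (occurrence⇒contains std1234 (mono₄ a<b b<c c<d) occ))
  (λ av con → let c , mono , occ = contains⇒occurrence std1234 con in
    <⇒≱ (mono 2F 3F 2F<3F) (av (mono 0F 1F z<s) (mono 1F 2F (s<s z<s)) (mono 1F 3F (s<s z<s)) occ))

avoids2134⇔ : ∀ w → Avoids w (2 ∷ 1 ∷ 3 ∷ 4 ∷ []) ⇔ Avoids21⊕ _≥_ w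
avoids2134⇔ w = mk⇔
  (λ av {_} {_} {_} {_} a<b b<c b<d occ → ≮⇒≥ λ c<d → av (occurrence⇒contains std2134 (mono₄ a<b b<c c<d) occ))
  (λ av con → let c , mono , occ = contains⇒occurrence std2134 con in
    <⇒≱ (mono 2F 3F 2F<3F) (av (mono 0F 1F z<s) (mono 1F 2F (s<s z<s)) (mono 1F 3F (s<s z<s)) occ))

-- Splits of a word

Site : Set
Site = Word × Word

splits : Word → List Site
splits []      = ([] , []) ∷ []
splits (x ∷ w) = ([] , x ∷ w) ∷ map (map₁ (x ∷_)) (splits w)

-- Only cuts in front of a letter of u; the cut between u and v is left to `splits v`, where it
-- heads the list.
splitsBefore : Word → Word → List Site
splitsBefore []      v = []
splitsBefore (x ∷ u) v = ([] , x ∷ u ++ v) ∷ map (map₁ (x ∷_)) (splitsBefore u v)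

splits-++ : ∀ u v → splits (u ++ v) ≡ splitsBefore u v ++ map (map₁ (u ++_)) (splits v)
splits-++ []      v = sym (map-id (splits v))
splits-++ (x ∷ u) v = cong (([] , x ∷ u ++ v) ∷_) (begin
  map (map₁ (x ∷_)) (splits (u ++ v))
    ≡⟨ cong (map _) (splits-++ u v) ⟩
  map (map₁ (x ∷_)) (splitsBefore u v ++ map (map₁ (u ++_)) (splits v))
    ≡⟨ map-++ _ (splitsBefore u v) _ ⟩
  map (map₁ (x ∷_)) (splitsBefore u v) ++ map (map₁ (x ∷_)) (map (map₁ (u ++_)) (splits v))
    ≡⟨ cong (map (map₁ (x ∷_)) (splitsBefore u v) ++_) (map-∘ (splits v)) ⟨
  map (map₁ (x ∷_)) (splitsBefore u v) ++ map (map₁ ((x ∷ u) ++_)) (splits v) ∎)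
  where open ≡-Reasoning

∈-splits⁻ : ∀ w {s} → s ∈ splits w → proj₁ s ++ proj₂ s ≡ w
∈-splits⁻ w s∈ = All.lookup (go w) s∈
  where
  go : ∀ w → All (λ s → proj₁ s ++ proj₂ s ≡ w) (splits w)
  go []      = refl ∷ []
  go (x ∷ w) = refl ∷ Allₚ.map⁺ (All.map (cong (x ∷_)) (go w))

∈-splits⁺ : ∀ u v → (u , v) ∈ splits (u ++ v)
∈-splits⁺ []      []      = here refl
∈-splits⁺ []      (_ ∷ _) = here refl
∈-splits⁺ (x ∷ u) v       = there (∈-map⁺ (map₁ (x ∷_)) (∈-splits⁺ u v))

length-splits : ∀ w → length (splits w) ≡ suc (length w)
length-splits []      = refl
length-splits (x ∷ w) = cong suc (trans (length-map _ (splits w)) (length-splits w))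

all-splits : {P : Site → Set} → (∀ u v → u ++ v ≡ w → P (u , v)) → All P (splits w)
all-splits {w} p = All.tabulate λ s∈ → p _ _ (∈-splits⁻ w s∈)

all-splitsBefore : ∀ {P : Site → Set} u {v} → (∀ u₁ x u₂ → u₁ ++ x ∷ u₂ ≡ u → P (u₁ , x ∷ u₂ ++ v)) →
                   All P (splitsBefore u v)
all-splitsBefore []      p = []
all-splitsBefore (x ∷ u) p =
  p [] x u refl ∷ Allₚ.map⁺ (all-splitsBefore u λ u₁ y u₂ eq → p (x ∷ u₁) y u₂ (cong (x ∷_) eq))

suffix-⊆ : ∀ u → u ++ v ≡ w → v ⊆ w
suffix-⊆ u eq = ⊆-trans (++⁺ˡ u ⊆-refl) (⊆-reflexive eq)

-- Counting splits

count : {P : A → Set} → Decidable P → List A → ℕ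
count P? xs = length (filter P? xs)

module _ {P : A → Set} (P? : Decidable P) where

  count-++ : ∀ xs ys → count P? (xs ++ ys) ≡ count P? xs + count P? ys
  count-++ xs ys = trans (cong length (filter-++ P? xs ys)) (length-++ (filter P? xs))

  count-all : ∀ {xs} → All P xs → count P? xs ≡ length xs
  count-all ps = cong length (filter-all P? ps)

  count-none : ∀ {xs} → All (¬_ ∘ P) xs → count P? xs ≡ 0
  count-none ps = cong length (filter-none P? ps)

  filter-map : (f : B → A) → ∀ xs → filter P? (map f xs) ≡ map f (filter (P? ∘ f) xs)
  filter-map f []       = refl
  filter-map f (x ∷ xs) with does (P? (f x))
  ... | true  = cong (f x ∷_) (filter-map f xs)
  ... | false = filter-map f xs

  count-map : (f : B → A) → ∀ xs → count P? (map f xs) ≡ count (P? ∘ f) xs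
  count-map f xs = trans (cong length (filter-map f xs)) (length-map f (filter (P? ∘ f) xs))

count-splits-cong : ∀ {P Q : Site → Set} (P? : Decidable P) (Q? : Decidable Q) w →
                    (∀ u v → u ++ v ≡ w → P (u , v) ⇔ Q (u , v)) →
                    count P? (splits w) ≡ count Q? (splits w)
count-splits-cong {P} {Q} P? Q? w e = go (splits w) (all-splits e)
  where
  go : ∀ ss → All (λ s → P s ⇔ Q s) ss → count P? ss ≡ count Q? ss
  go []       []       = refl
  go (s ∷ ss) (e ∷ es) with P? s
  ... | yes p = trans (cong suc (go ss es)) (cong length (sym (filter-accept Q? (Equivalence.to e p))))
  ... | no ¬p = trans (go ss es) (cong length (sym (filter-reject Q? (¬p ∘ Equivalence.from e))))

-- The right parts may differ, so that cuts inside u can be compared before and after an insertion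
-- behind u.
countBefore-cong : ∀ {P Q : Site → Set} (P? : Decidable P) (Q? : Decidable Q) u {v v′} →
                   (∀ u₁ x u₂ → u₁ ++ x ∷ u₂ ≡ u → P (u₁ , x ∷ u₂ ++ v) ⇔ Q (u₁ , x ∷ u₂ ++ v′)) →
                   count P? (splitsBefore u v) ≡ count Q? (splitsBefore u v′)
countBefore-cong P? Q? []      e = refl
countBefore-cong P? Q? (x ∷ u) {v} {v′} e
  with rec ← trans (count-map P? (map₁ (x ∷_)) (splitsBefore u v)) (trans
               (countBefore-cong (P? ∘ map₁ (x ∷_)) (Q? ∘ map₁ (x ∷_)) u
                 (λ u₁ y u₂ eq → e (x ∷ u₁) y u₂ (cong (x ∷_) eq)))
               (sym (count-map Q? (map₁ (x ∷_)) (splitsBefore u v′))))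
  with P? ([] , x ∷ u ++ v)
... | yes p = trans (cong suc rec) (cong length (sym (filter-accept Q? (Equivalence.to (e [] x u refl) p))))
... | no ¬p = trans rec (cong length (sym (filter-reject Q? (¬p ∘ Equivalence.from (e [] x u refl)))))

module _ {P : Site → Set} (P? : Decidable P) where

  countAfter : Word → Word → ℕ
  countAfter u v = count (P? ∘ map₁ (u ++_)) (splits v)

  count-splits-++ : ∀ u v → count P? (splits (u ++ v)) ≡ count P? (splitsBefore u v) + countAfter u v
  count-splits-++ u v = begin
    count P? (splits (u ++ v))
      ≡⟨ cong (count P?) (splits-++ u v) ⟩
    count P? (splitsBefore u v ++ map (map₁ (u ++_)) (splits v))
      ≡⟨ count-++ P? (splitsBefore u v) _ ⟩
    count P? (splitsBefore u v) + count P? (map (map₁ (u ++_)) (splits v))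
      ≡⟨ cong (count P? (splitsBefore u v) +_) (count-map P? (map₁ (u ++_)) (splits v)) ⟩
    count P? (splitsBefore u v) + countAfter u v ∎
    where open ≡-Reasoning

  count-splits-all : (∀ u v → u ++ v ≡ w → P (u , v)) → count P? (splits w) ≡ suc (length w)
  count-splits-all {w} p = trans (count-all P? (all-splits p)) (length-splits w)

-- A property inherited by sublists holds for the right parts up to some length and for no longer
-- ones. The count of such splits is therefore a threshold: comparing it with the length of a right
-- part decides the property.
module Suffix {F : Word → Set} (F? : Decidable F) (F-⊆ : ∀ {u v} → u ⊆ v → F v → F u) where

  suffixCount : Word → ℕ
  suffixCount w = count (F? ∘ proj₂) (splits w)

  suffixCount-all : F w → suffixCount w ≡ suc (length w)
  suffixCount-all {w} Fw = count-splits-all (F? ∘ proj₂) λ u v eq → F-⊆ (suffix-⊆ u eq) Fw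

  suffixCount-¬ : ∀ u → ¬ F v → suffixCount (u ++ v) ≡ suffixCount v
  suffixCount-¬ {v} u ¬Fv = trans (count-splits-++ (F? ∘ proj₂) u v)
    (cong (_+ suffixCount v) (count-none (F? ∘ proj₂)
      (all-splitsBefore u λ _ x u₂ _ → ¬Fv ∘ F-⊆ (++⁺ˡ (x ∷ u₂) ⊆-refl))))

  suffixCount-¬∷ : ∀ {x} → ¬ F (x ∷ v) → suffixCount (x ∷ v) ≡ suffixCount v
  suffixCount-¬∷ {v} {x} ¬F = trans (cong length (filter-reject (F? ∘ proj₂) ¬F))
    (count-map (F? ∘ proj₂) (map₁ (x ∷_)) (splits v))

  suffixCount-> : ∀ u → F v → length v < suffixCount (u ++ v)
  suffixCount-> {v} u Fv = ≤-trans (≤-reflexive (sym (suffixCount-all Fv)))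
    (≤-trans (m≤n+m _ _) (≤-reflexive (sym (count-splits-++ (F? ∘ proj₂) u v))))

  suffixCount-≤ : ∀ u → ¬ F v → suffixCount (u ++ v) ≤ length v
  suffixCount-≤ {v} u ¬Fv = ≤-trans (≤-reflexive (suffixCount-¬ u ¬Fv)) (go v ¬Fv)
    where
    go : ∀ v → ¬ F v → suffixCount v ≤ length v
    go []      ¬Fv = ≤-reflexive (cong length (filter-reject (F? ∘ proj₂) ¬Fv))
    go (x ∷ v) ¬Fv = ≤-trans (≤-reflexive (suffixCount-¬∷ ¬Fv))
      (≤-trans (length-filter (F? ∘ proj₂) (splits v)) (≤-reflexive (length-splits v)))

  private
    lengths-splits : ∀ w → map (length ∘ proj₂) (splits w) ≡ downFrom (suc (length w))
    lengths-splits []      = refl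
    lengths-splits (x ∷ w) = cong (suc (length w) ∷_) (trans (sym (map-∘ (splits w))) (lengths-splits w))

  suffixLengths : ∀ w → map (length ∘ proj₂) (filter (F? ∘ proj₂) (splits w)) ≡ downFrom (suffixCount w)
  suffixLengths w with F? w
  ... | yes Fw = begin
    map (length ∘ proj₂) (filter (F? ∘ proj₂) (splits w))
      ≡⟨ cong (map _) (filter-all (F? ∘ proj₂) (all-splits λ u v eq → F-⊆ (suffix-⊆ u eq) Fw)) ⟩
    map (length ∘ proj₂) (splits w)
      ≡⟨ lengths-splits w ⟩
    downFrom (suc (length w))
      ≡⟨ cong downFrom (suffixCount-all Fw) ⟨
    downFrom (suffixCount w) ∎
    where open ≡-Reasoning
  suffixLengths [] | no ¬Fw = trans (cong (map (length ∘ proj₂)) rejected) (cong (downFrom ∘ length) (sym rejected))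
    where
    rejected : filter (F? ∘ proj₂) (splits []) ≡ []
    rejected = filter-reject (F? ∘ proj₂) {xs = []} ¬Fw
  suffixLengths (x ∷ w) | no ¬Fw = begin
    map (length ∘ proj₂) (filter (F? ∘ proj₂) (splits (x ∷ w)))
      ≡⟨ cong (map _) (filter-reject (F? ∘ proj₂) ¬Fw) ⟩
    map (length ∘ proj₂) (filter (F? ∘ proj₂) (map (map₁ (x ∷_)) (splits w)))
      ≡⟨ cong (map _) (filter-map (F? ∘ proj₂) (map₁ (x ∷_)) (splits w)) ⟩
    map (length ∘ proj₂) (map (map₁ (x ∷_)) (filter (F? ∘ proj₂) (splits w)))
      ≡⟨ map-∘ _ ⟨
    map (length ∘ proj₂) (filter (F? ∘ proj₂) (splits w))
      ≡⟨ suffixLengths w ⟩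
    downFrom (suffixCount w)
      ≡⟨ cong downFrom (suffixCount-¬∷ ¬Fw) ⟨
    downFrom (suffixCount (x ∷ w)) ∎
    where open ≡-Reasoning

pairs? : {P : Rel} → (∀ c d → Dec (P c d)) → ∀ w → Dec (∀ c d → c ∷ d ∷ [] ⊆ w → P c d)
pairs? P? []      = yes λ _ _ ()
pairs? P? (x ∷ w) = map′
  (λ { (_ , f) c d (.x ∷ʳ p) → f c d p ; (h , _) c d (refl ∷ p) → All.lookup h (to∈ p) })
  (λ h → All.tabulate (λ d∈w → h _ _ (refl ∷ from∈ d∈w)) , λ c d p → h c d (x ∷ʳ p))
  (All.all? (P? x) w ×-dec pairs? P? w)

triples? : {P : ℕ → Rel} → (∀ b c d → Dec (P b c d)) → ∀ w → Dec (∀ b c d → b ∷ c ∷ d ∷ [] ⊆ w → P b c d)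
triples? P? []      = yes λ _ _ _ ()
triples? P? (x ∷ w) = map′
  (λ { (_ , f) b c d (.x ∷ʳ p) → f b c d p ; (h , _) b c d (refl ∷ p) → h c d p })
  (λ h → (λ c d p → h _ c d (refl ∷ p)) , λ b c d p → h b c d (x ∷ʳ p))
  (pairs? (P? x) w ×-dec triples? P? w)

-- Occurrences in a word with an inserted least letter

⊆-filter : All (i <_) τ → τ ⊆ w → τ ⊆ filter (i <?_) w
⊆-filter {i} big τ⊆w = ⊆-trans (⊆-reflexive (sym (filter-all (i <?_) big)))
  (filter⁺ (i <?_) (i <?_) (λ { refl i<x → i<x }) τ⊆w)

filter-insert : ∀ {t} → All (i <_) u → filter (i <?_) (u ++ i ∷ t) ≡ u ++ filter (i <?_) t
filter-insert {i} {u} {t} u> = trans (filter-++ (i <?_) u (i ∷ t))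
  (cong₂ _++_ (filter-all (i <?_) u>) (filter-reject (i <?_) {xs = t} (<-irrefl refl)))

-- An occurrence made of letters above i avoids all copies of i, so it was present before the
-- insertion.
large-insert : ∀ {t} → All (i <_) u → filter (i <?_) t ≡ v → All (i <_) τ → τ ⊆ u ++ i ∷ t → τ ⊆ u ++ v
large-insert {u = u} u> eq τ> p =
  ⊆-trans (⊆-filter τ> p) (⊆-reflexive (trans (filter-insert u>) (cong (u ++_) eq)))

after-least : ∀ {t} → All (i <_) u → i ∷ τ ⊆ u ++ i ∷ t → τ ⊆ t
after-least []        (_ ∷ʳ p)   = ∷ˡ⁻ p
after-least []        (refl ∷ p) = p
after-least (_ ∷ u>)  (_ ∷ʳ p)   = after-least u> p
after-least (i<i ∷ _) (refl ∷ p) = contradiction i<i (<-irrefl refl)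

-- If j is taken from u, the i of the occurrence is the first i or a later one, so τ lies behind the
-- first i. Otherwise the whole occurrence starts behind it.
before-least : ∀ {t} → All (i <_) u → i < j → j ∷ i ∷ τ ⊆ u ++ i ∷ t → (j ∈ u × τ ⊆ t) ⊎ (j ∷ i ∷ τ ⊆ t)
before-least []       i<j (_ ∷ʳ p)   = inj₂ p
before-least []       i<i (refl ∷ p) = contradiction i<i (<-irrefl refl)
before-least (_ ∷ u>) i<j (_ ∷ʳ p) with before-least u> i<j p
... | inj₁ (j∈u , q) = inj₁ (there j∈u , q)
... | inj₂ q         = inj₂ q
before-least (_ ∷ u>) i<j (refl ∷ p) = inj₁ (here refl , after-least u> p)

-- Avoidance of σ and of 1⊕σ

module Order (S : Rel) (S? : ∀ x y → Dec (S x y)) where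

  Sorted Tri : Word → Set
  Sorted w = ∀ c d → c ∷ d ∷ [] ⊆ w → S c d
  Tri    w = ∀ b c d → b ∷ c ∷ d ∷ [] ⊆ w → b < c → b < d → S c d

  -- The test that a letter j put in front of w is not the 1 of a copy of 1⊕σ.
  Above : ℕ → Word → Set
  Above j w = ∀ c d → c ∷ d ∷ [] ⊆ w → j < c → j < d → S c d

  sorted? : Decidable Sorted
  sorted? = pairs? S?

  above? : ∀ j → Decidable (Above j)
  above? j = pairs? λ c d → (j <? c) →-dec (j <? d) →-dec S? c d

  tri? : Decidable Tri
  tri? = triples? λ b c d → (b <? c) →-dec (b <? d) →-dec S? c d

  sorted-⊆ : u ⊆ v → Sorted v → Sorted u
  sorted-⊆ u⊆v s c d p = s c d (⊆-trans p u⊆v)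

  above-⊆ : u ⊆ v → Above j v → Above j u
  above-⊆ u⊆v s c d p = s c d (⊆-trans p u⊆v)

  tri-⊆ : u ⊆ v → Tri v → Tri u
  tri-⊆ u⊆v s b c d p = s b c d (⊆-trans p u⊆v)

  sorted⇒tri : Sorted v → Tri v
  sorted⇒tri s b c d p _ _ = s c d (∷ˡ⁻ p)

  above⇔sorted : All (i <_) v → Above i v ⇔ Sorted v
  above⇔sorted v> = mk⇔
    (λ s c d p → case All-resp-⊆ p v> of λ { (i<c ∷ i<d ∷ []) → s c d p i<c i<d })
    (λ s c d p _ _ → s c d p)

  above-filter : i ≤ j → Above j (filter (i <?_) w) → Above j w
  above-filter i≤j s c d p j<c j<d = s c d (⊆-filter (≤-<-trans i≤j j<c ∷ ≤-<-trans i≤j j<d ∷ []) p) j<c j<d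

  open module SortedSuffix = Suffix sorted? sorted-⊆ public using ()
    renaming (suffixCount to sortedCount)
  open module TriSuffix = Suffix tri? tri-⊆ public using ()
    renaming (suffixCount to triCount)
  module AboveSuffix j = Suffix (above? j) (above-⊆ {j = j})
  open AboveSuffix public using () renaming (suffixCount to aboveCount)

upFrom : ℕ → ℕ → List ℕ
upFrom n zero    = []
upFrom n (suc m) = n ∷ upFrom (suc n) m

-- For 21⊕σ the ranks come out as an ascending run followed by a descending one; this turns them
-- into the standard list.
upFrom-downFrom : ∀ n m → upFrom n m ++ downFrom n ↭ downFrom (m + n)
upFrom-downFrom n zero    = ↭-refl
upFrom-downFrom n (suc m) = ↭-trans (↭-sym (Permₚ.shift n (upFrom (suc n) m) (downFrom n)))
  (↭-trans (upFrom-downFrom (suc n) m) (↭-reflexive (cong downFrom (+-suc m n))))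

-- The two insertion criteria

module Insertion (S : Rel) (S? : ∀ x y → Dec (S x y)) where
  open Order S S?

  -- A multiset word with least letter i is u ++ i ∷ tail i a v, where u ++ v is the word of its larger letters
  -- and a is the number of further copies of i.
  record Scheme : Set₁ where
    field
      Base           : Word → Set
      tail           : ℕ → ℕ → Word → Word
      base-[]        : Base []
      base-⊆         : u ⊆ v → Base v → Base u
      base-insert    : All (i <_) u → All (i <_) v → Base (u ++ v) → Base (u ++ i ∷ tail i a v)
      base-decompose : All (i ≤_) w → occurrences i w ≡ suc a → Base w →
                       ∃₂ λ u v → All (i <_) u × All (i <_) v × w ≡ u ++ i ∷ tail i a v
      filter-tail    : All (i <_) v → filter (i <?_) (tail i a v) ≡ v
      tail-≥         : All (i <_) v → All (i ≤_) (tail i a v)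
      length-tail    : length (tail i a v) ≡ a + length v
      occurrences-tail : All (i <_) v → occurrences i (tail i a v) ≡ a
      tail-pattern   : All (i <_) v → i < b → i < c → ¬ b ∷ i ∷ c ∷ [] ⊆ tail i a v

      -- The transition of the state (p , q), where q is the number of suffixes avoiding σ.
      extra          : ℕ → ℕ
      qUnsorted      : ℕ → ℕ → ℕ
      qSorted        : ℕ → ℕ → ℕ → ℕ
      tri-tail       : All (i <_) v → ¬ Sorted v → Tri v → triCount (tail i a v) ≡ extra a + suc (length v)
      above-tail     : All (i <_) v → ¬ Sorted v → aboveCount i (tail i a v) ≡ extra a + sortedCount v
      sorted-tail    : All (i <_) v → ¬ Sorted v → sortedCount (tail i a v) ≡ qUnsorted a (sortedCount v)
      sorted-insert  : All (i <_) u → All (i <_) v → Sorted v →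
                       sortedCount (u ++ i ∷ tail i a v) ≡ qSorted (length v) a (sortedCount (u ++ v))

  module Insert (sch : Scheme) where
    open Scheme sch

    insert : ℕ → ℕ → Site → Word
    insert i a (u , v) = u ++ i ∷ tail i a v

    -- A generating tree for 12⊕σ or 21⊕σ: Ok marks the splits at which the next letter may be inserted, and the
    -- state of a child depends only on the state of its parent and on the rank of the split.
    record Track : Set₁ where
      field
        Ok   : Site → Set
        ok?  : Decidable Ok
        rank : Site → ℕ

      okCount : Word → ℕ
      okCount w = count ok? (splits w)

      field
        ranks          : ∀ w → map rank (filter ok? (splits w)) ↭ downFrom (okCount w)
        rank-sorted    : Sorted v → rank (u , v) ≡ length v
        rank-unsorted  : ¬ Sorted v → sortedCount (u ++ v) ≤ rank (u , v)
        okCount-[]     : okCount [] ≡ 1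
        count-sorted   : All (i <_) u → All (i <_) v → Sorted v →
                         okCount (insert i a (u , v)) ≡ okCount (u ++ v) + suc a
        count-unsorted : All (i <_) u → All (i <_) v → ¬ Sorted v → Ok (u , v) →
                         okCount (insert i a (u , v)) ≡ suc (rank (u , v) + extra a)
        Av             : Word → Set
        av-[]          : Av []
        av-insert⁺     : All (i <_) u → All (i <_) v → Av (u ++ v) → Ok (u , v) → Av (insert i a (u , v))
        av-insert⁻     : All (i <_) u → All (i <_) v → Av (insert i a (u , v)) → Av (u ++ v) × Ok (u , v)

    -- The left side counts the splits of `i ∷ tail i a v`, the right side those of v plus the
    -- multiplicity of i; n stands for the cuts inside u.
    +-length-tail : ∀ n → n + suc (suc (length (tail i a v))) ≡ n + suc (length v) + suc a
    +-length-tail {i} {a} {v} n = begin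
      n + suc (suc (length (tail i a v)))  ≡⟨ cong (λ l → n + suc (suc l)) (trans length-tail (+-comm a (length v))) ⟩
      n + suc (suc (length v + a))         ≡⟨ cong (n +_) (+-suc (suc (length v)) a) ⟨
      n + (suc (length v) + suc a)         ≡⟨ +-assoc n (suc (length v)) (suc a) ⟨
      n + suc (length v) + suc a           ∎
      where open ≡-Reasoning

    module _ {i a : ℕ} {v : Word} (v> : All (i <_) v) where

      ⊆-tail : v ⊆ tail i a v
      ⊆-tail = ⊆-trans (⊆-reflexive (sym (filter-tail v>))) (filter-⊆ (i <?_) (tail i a v))

      large-⊆-tail : All (i <_) τ → τ ⊆ tail i a v → τ ⊆ v
      large-⊆-tail τ> p = ⊆-trans (⊆-filter τ> p) (⊆-reflexive (filter-tail v>))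

    module _ {i a : ℕ} {u v : Word} (u> : All (i <_) u) (v> : All (i <_) v) where
      private
        t = tail i a v

      insert-≥ : All (i ≤_) (u ++ i ∷ t)
      insert-≥ = Allₚ.++⁺ (All.map <⇒≤ u>) (≤-refl ∷ tail-≥ v>)

      filter-inserted : filter (i <?_) (u ++ i ∷ t) ≡ u ++ v
      filter-inserted = trans (filter-insert u>) (cong (u ++_) (filter-tail v>))

      ⊆-insert : u ++ v ⊆ u ++ i ∷ t
      ⊆-insert = ++⁺ (⊆-refl {x = u}) (i ∷ʳ ⊆-tail v>)

      large-⊆ : All (i <_) τ → τ ⊆ u ++ i ∷ t → τ ⊆ u ++ v
      large-⊆ = large-insert u> (filter-tail v>)

    -- Only i could be a new 1. Its copy of σ would consist of larger letters behind the first i,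
    -- hence of letters of v, which avoids σ.
    tri-insert : All (i <_) u → All (i <_) v → Sorted v → Tri (u ++ v) → Tri (insert i a (u , v))
    tri-insert u> v> s tri b c d p b<c b<d with i≤b ∷ _ ← All-resp-⊆ p (insert-≥ u> v>) with m≤n⇒m<n∨m≡n i≤b
    ... | inj₁ i<b  = tri b c d (large-⊆ u> v> (i<b ∷ <-trans i<b b<c ∷ <-trans i<b b<d ∷ []) p) b<c b<d
    ... | inj₂ refl = s c d (large-⊆-tail v> (b<c ∷ b<d ∷ []) (after-least u> p))

    track12⊕ : Track
    track12⊕ = record
      { Ok             = Tri ∘ proj₂
      ; ok?            = tri? ∘ proj₂
      ; rank           = length ∘ proj₂
      ; ranks          = λ w → ↭-reflexive (TriSuffix.suffixLengths w)
      ; rank-sorted    = λ _ → refl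
      ; rank-unsorted  = λ {v} {u} → SortedSuffix.suffixCount-≤ u
      ; okCount-[]     = TriSuffix.suffixCount-all {w = []} λ _ _ _ ()
      ; count-sorted   = count-sorted
      ; count-unsorted = count-unsorted
      ; Av             = Avoids12⊕ S
      ; av-[]          = λ _ _ _ ()
      ; av-insert⁺     = av-insert⁺
      ; av-insert⁻     = λ {i} {u} {v} u> v> av →
          (λ a<b b<c b<d p → av a<b b<c b<d (⊆-trans p (⊆-insert u> v>))) ,
          λ b c d p b<c b<d → case All-resp-⊆ p v> of λ { (i<b ∷ _) →
            av i<b b<c b<d (++⁺ˡ u (refl ∷ ⊆-trans p (⊆-tail v>))) }
      }
      where
      -- All cuts behind u are admissible before and after the insertion, and the cuts inside u keep
      -- their status; so the count grows by the number of inserted letters.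
      count-sorted : All (i <_) u → All (i <_) v → Sorted v →
                     triCount (insert i a (u , v)) ≡ triCount (u ++ v) + suc a
      count-sorted {i} {u} {v} {a} u> v> s = begin
        triCount (insert i a (u , v))
          ≡⟨ count-splits-++ (tri? ∘ proj₂) u (i ∷ t) ⟩
        count (tri? ∘ proj₂) (splitsBefore u (i ∷ t)) + triCount (i ∷ t)
          ≡⟨ cong₂ _+_ before (TriSuffix.suffixCount-all (tri-insert [] v> s (sorted⇒tri s))) ⟩
        pre + suc (suc (length t))
          ≡⟨ +-length-tail pre ⟩
        pre + suc (length v) + suc a
          ≡⟨ cong (λ n → pre + n + suc a) (TriSuffix.suffixCount-all (sorted⇒tri s)) ⟨
        pre + triCount v + suc a
          ≡⟨ cong (_+ suc a) (count-splits-++ (tri? ∘ proj₂) u v) ⟨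
        triCount (u ++ v) + suc a ∎
        where
        open ≡-Reasoning
        t = tail i a v
        pre = count (tri? ∘ proj₂) (splitsBefore u v)
        before : count (tri? ∘ proj₂) (splitsBefore u (i ∷ t)) ≡ pre
        before = countBefore-cong (tri? ∘ proj₂) (tri? ∘ proj₂) u λ u₁ x u₂ eq →
          let u₂> = All-resp-⊆ (suffix-⊆ u₁ eq) u> in
          mk⇔ (tri-⊆ (⊆-insert u₂> v>)) (tri-insert u₂> v> s)

      -- The inserted i completes a copy of σ in v to 1⊕σ, so every cut in front of it is lost and
      -- only cuts in the tail can remain.
      count-unsorted : All (i <_) u → All (i <_) v → ¬ Sorted v → Tri v →
                       triCount (insert i a (u , v)) ≡ suc (length v + extra a)
      count-unsorted {i} {u} {v} {a} u> v> ¬s tri = begin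
        triCount (u ++ i ∷ tail i a v) ≡⟨ TriSuffix.suffixCount-¬ u ¬tri ⟩
        triCount (i ∷ tail i a v)      ≡⟨ TriSuffix.suffixCount-¬∷ ¬tri ⟩
        triCount (tail i a v)          ≡⟨ tri-tail v> ¬s tri ⟩
        extra a + suc (length v)       ≡⟨ +-comm (extra a) _ ⟩
        suc (length v + extra a)       ∎
        where
        open ≡-Reasoning
        ¬tri : ¬ Tri (i ∷ tail i a v)
        ¬tri h = ¬s (Equivalence.to (above⇔sorted v>)
          λ c d p → h i c d (refl ∷ ⊆-trans p (⊆-tail v>)))

      av-insert⁺ : All (i <_) u → All (i <_) v → Avoids12⊕ S (u ++ v) → Tri v → Avoids12⊕ S (insert i a (u , v))
      av-insert⁺ u> v> av tri {b = b} {c} {d} a<b b<c b<d p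
        with i≤a ∷ _ ← All-resp-⊆ p (insert-≥ u> v>) with m≤n⇒m<n∨m≡n i≤a
      ... | inj₁ i<a =
        let i<b = <-trans i<a a<b
        in av a<b b<c b<d (large-⊆ u> v> (i<a ∷ i<b ∷ <-trans i<b b<c ∷ <-trans i<b b<d ∷ []) p)
      ... | inj₂ refl =
        tri b c d (large-⊆-tail v> (a<b ∷ <-trans a<b b<c ∷ <-trans a<b b<d ∷ []) (after-least u> p)) b<c b<d

    -- No letter of u may serve as the 2 of 21⊕σ when the inserted letter serves as the 1.
    Open : Site → Set
    Open (u , v) = All (λ j → Above j v) u

    open? : Decidable Open
    open? (u , v) = All.all? (λ j → above? j v) u

    openCount : Word → ℕ
    openCount w = count open? (splits w)

    openBefore : Word → Word → ℕ
    openBefore u v = count open? (splitsBefore u v)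

    sorted⇒open : ∀ u → Sorted v → Open (u , v)
    sorted⇒open u s = All.universal (λ j c d p _ _ → s c d p) u

    -- Inserting at an unsorted split leaves open the splits that were open up to there and all sorted ones, so
    -- the unsorted open splits are ranked from left to right, above the sorted ones.
    openRank : Site → ℕ
    openRank (u , v) with sorted? v
    ... | yes _ = length v
    ... | no  _ = openBefore u v + sortedCount v

    openRank-sorted : Sorted v → openRank (u , v) ≡ length v
    openRank-sorted {v} s with sorted? v
    ... | yes _ = refl
    ... | no ¬s = contradiction s ¬s

    openRank-unsorted : ¬ Sorted v → openRank (u , v) ≡ openBefore u v + sortedCount v
    openRank-unsorted {v} ¬s with sorted? v
    ... | yes s = contradiction s ¬s
    ... | no  _ = refl

    splitsBefore-∷ʳ : ∀ u x v → splitsBefore (u ++ [ x ]) v ≡ splitsBefore u (x ∷ v) ++ [ u , x ∷ v ]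
    splitsBefore-∷ʳ []      x v = refl
    splitsBefore-∷ʳ (y ∷ u) x v = cong₂ _∷_ (cong (λ w → [] , y ∷ w) (++-assoc u [ x ] v))
      (trans (cong (map _) (splitsBefore-∷ʳ u x v)) (map-++ _ (splitsBefore u (x ∷ v)) _))

    -- The prefix u is kept in each split because openness depends on the letters to the left of the
    -- cut.
    splitsAfter : Word → Word → List Site
    splitsAfter u v = map (map₁ (u ++_)) (splits v)

    splitsAfter-∷ : ∀ u x v → splitsAfter u (x ∷ v) ≡ (u , x ∷ v) ∷ splitsAfter (u ++ [ x ]) v
    splitsAfter-∷ u x v = cong₂ _∷_ (cong (_, x ∷ v) (++-identityʳ u))
      (trans (sym (map-∘ (splits v))) (map-cong (λ (u₁ , u₂) → cong (_, u₂) (sym (++-assoc u [ x ] u₁))) (splits v)))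

    ranksFrom-sorted : ∀ u → Sorted v → map openRank (filter open? (splitsAfter u v)) ≡ downFrom (sortedCount v)
    ranksFrom-sorted {v} u s = begin
      map openRank (filter open? (splitsAfter u v))
        ≡⟨ cong (map openRank) (filter-all open? (Allₚ.map⁺ (all-splits λ u₁ u₂ eq →
             sorted⇒open (u ++ u₁) (sorted-suffix u₁ eq)))) ⟩
      map openRank (map (map₁ (u ++_)) (splits v))
        ≡⟨ map-∘ (splits v) ⟨
      map (openRank ∘ map₁ (u ++_)) (splits v)
        ≡⟨ map-cong-local (all-splits λ u₁ u₂ eq → openRank-sorted (sorted-suffix u₁ eq)) ⟩
      map (length ∘ proj₂) (splits v)
        ≡⟨ cong (map (length ∘ proj₂)) (filter-all (sorted? ∘ proj₂) (all-splits λ u₁ u₂ eq → sorted-suffix u₁ eq)) ⟨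
      map (length ∘ proj₂) (filter (sorted? ∘ proj₂) (splits v))
        ≡⟨ SortedSuffix.suffixLengths v ⟩
      downFrom (sortedCount v) ∎
      where
      open ≡-Reasoning
      sorted-suffix : ∀ u₁ {u₂} → u₁ ++ u₂ ≡ v → Sorted u₂
      sorted-suffix u₁ eq = sorted-⊆ (suffix-⊆ u₁ eq) s

    openBefore-∷ʳ : ∀ u x v → openBefore (u ++ [ x ]) v ≡ openBefore u (x ∷ v) + count open? [ u , x ∷ v ]
    openBefore-∷ʳ u x v = trans (cong (count open?) (splitsBefore-∷ʳ u x v)) (count-++ open? (splitsBefore u (x ∷ v)) _)

    -- The cuts are scanned from left to right. While the right part contains σ, `sortedCount` is
    -- constant and `openBefore` grows exactly at open cuts, so the ranks ascend from q. Once it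
    -- avoids σ, the ranks are the remaining lengths and descend from q - 1.
    ranksFrom : ∀ u v → ∃ λ m → map openRank (filter open? (splitsAfter u v)) ≡
                upFrom (openBefore u v + sortedCount v) m ++ downFrom (sortedCount v)
    ranksFrom u v with sorted? v
    ... | yes s = 0 , ranksFrom-sorted u s
    ranksFrom u []      | no ¬s = contradiction (λ _ _ ()) ¬s
    ranksFrom u (x ∷ v) | no ¬s with m , eq ← ranksFrom (u ++ [ x ]) v with open? (u , x ∷ v)
    ... | yes o = suc m , (begin
      map openRank (filter open? (splitsAfter u (x ∷ v)))
        ≡⟨ cong (map openRank ∘ filter open?) (splitsAfter-∷ u x v) ⟩
      map openRank (filter open? ((u , x ∷ v) ∷ splitsAfter (u ++ [ x ]) v))
        ≡⟨ cong (map openRank) (filter-accept open? o) ⟩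
      openRank (u , x ∷ v) ∷ map openRank (filter open? (splitsAfter (u ++ [ x ]) v))
        ≡⟨ cong₂ _∷_ (openRank-unsorted ¬s) eq ⟩
      openBefore u (x ∷ v) + sortedCount (x ∷ v) ∷
        upFrom (openBefore (u ++ [ x ]) v + sortedCount v) m ++ downFrom (sortedCount v)
        ≡⟨ cong₂ (λ b q → openBefore u (x ∷ v) + sortedCount (x ∷ v) ∷ upFrom (b + q) m ++ downFrom q)
             (trans (openBefore-∷ʳ u x v) (trans
               (cong (openBefore u (x ∷ v) +_) (count-all open? (o ∷ []))) (+-comm _ 1)))
             (sym (SortedSuffix.suffixCount-¬∷ ¬s)) ⟩
      upFrom (openBefore u (x ∷ v) + sortedCount (x ∷ v)) (suc m) ++ downFrom (sortedCount (x ∷ v)) ∎)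
      where open ≡-Reasoning
    ... | no ¬o = m , (begin
      map openRank (filter open? (splitsAfter u (x ∷ v)))
        ≡⟨ cong (map openRank ∘ filter open?) (splitsAfter-∷ u x v) ⟩
      map openRank (filter open? ((u , x ∷ v) ∷ splitsAfter (u ++ [ x ]) v))
        ≡⟨ cong (map openRank) (filter-reject open? ¬o) ⟩
      map openRank (filter open? (splitsAfter (u ++ [ x ]) v))
        ≡⟨ eq ⟩
      upFrom (openBefore (u ++ [ x ]) v + sortedCount v) m ++ downFrom (sortedCount v)
        ≡⟨ cong₂ (λ b q → upFrom (b + q) m ++ downFrom q)
             (trans (openBefore-∷ʳ u x v) (trans
               (cong (openBefore u (x ∷ v) +_) (count-none open? (¬o ∷ []))) (+-identityʳ _)))
             (sym (SortedSuffix.suffixCount-¬∷ ¬s)) ⟩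
      upFrom (openBefore u (x ∷ v) + sortedCount (x ∷ v)) m ++ downFrom (sortedCount (x ∷ v)) ∎)
      where open ≡-Reasoning

    openRanks : ∀ w → map openRank (filter open? (splits w)) ↭ downFrom (openCount w)
    openRanks w with m , eq ← ranksFrom [] w =
      subst (λ n → ranked ↭ downFrom n) (sym count≡) perm
      where
      ranked = map openRank (filter open? (splits w))
      perm : ranked ↭ downFrom (m + sortedCount w)
      perm = ↭-trans (↭-reflexive (trans (cong (map openRank ∘ filter open?) (sym (map-id (splits w)))) eq))
                     (upFrom-downFrom (sortedCount w) m)
      -- The number m of open splits with σ on the right is never computed; comparing lengths
      -- identifies it.
      count≡ : openCount w ≡ m + sortedCount w
      count≡ = trans (sym (length-map openRank (filter open? (splits w))))
                     (trans (Permₚ.↭-length perm) (length-downFrom _))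

    -- The test of a letter j of u₁ ignores letters up to j, and i < j, so the copies of i on the
    -- right are invisible to it.
    open-insert : ∀ {u₁ u₂} → All (i <_) u₁ → All (i <_) u₂ → All (i <_) v →
                  Open (u₁ , u₂ ++ v) ⇔ Open (u₁ , u₂ ++ i ∷ tail i a v)
    open-insert u₁> u₂> v> = mk⇔
      (λ o → All.zipWith
        (λ (i<j , ab) → above-filter (<⇒≤ i<j) (subst (Above _) (sym (filter-inserted u₂> v>)) ab)) (u₁> , o))
      (All.map (above-⊆ (⊆-insert u₂> v>)))

    openBefore-insert : All (i <_) u → All (i <_) v → openBefore u (i ∷ tail i a v) ≡ openBefore u v
    openBefore-insert {u = u} u> v> = countBefore-cong open? open? u λ u₁ x u₂ eq →
      let x∷u₂> = All-resp-⊆ (suffix-⊆ u₁ eq) u>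
          u₁>   = Allₚ.++⁻ˡ u₁ (subst (All _) (sym eq) u>)
          e     = open-insert u₁> x∷u₂> v>
      in mk⇔ (Equivalence.from e) (Equivalence.to e)

    track21⊕ : Track
    track21⊕ = record
      { Ok             = Open
      ; ok?            = open?
      ; rank           = openRank
      ; ranks          = openRanks
      ; rank-sorted    = openRank-sorted
      ; rank-unsorted  = λ {v} {u} ¬s → ≤-trans (≤-reflexive (SortedSuffix.suffixCount-¬ u ¬s))
                           (≤-trans (m≤n+m _ _) (≤-reflexive (sym (openRank-unsorted ¬s))))
      ; okCount-[]     = count-all open? {[ [] , [] ]} ([] ∷ [])
      ; count-sorted   = count-sorted
      ; count-unsorted = count-unsorted
      ; Av             = Avoids21⊕ S
      ; av-[]          = λ _ _ _ ()
      ; av-insert⁺     = av-insert⁺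
      ; av-insert⁻     = av-insert⁻
      }
      where
      -- All letters are at least i, and the letters above i behind the cut come from v, which
      -- avoids σ. So every cut behind u is open, as it was before.
      count-sorted : All (i <_) u → All (i <_) v → Sorted v →
                     openCount (insert i a (u , v)) ≡ openCount (u ++ v) + suc a
      count-sorted {i} {u} {v} {a} u> v> s = begin
        openCount (insert i a (u , v))
          ≡⟨ count-splits-++ open? u (i ∷ t) ⟩
        openBefore u (i ∷ t) + countAfter open? u (i ∷ t)
          ≡⟨ cong₂ _+_ (openBefore-insert u> v>) (count-splits-all (open? ∘ map₁ (u ++_)) after) ⟩
        pre + suc (suc (length t))
          ≡⟨ +-length-tail pre ⟩
        pre + suc (length v) + suc a
          ≡⟨ cong (λ n → pre + n + suc a) (count-splits-all (open? ∘ map₁ (u ++_)) λ u₁ u₂ eq →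
               sorted⇒open (u ++ u₁) (sorted-⊆ (suffix-⊆ u₁ eq) s)) ⟨
        pre + countAfter open? u v + suc a
          ≡⟨ cong (_+ suc a) (count-splits-++ open? u v) ⟨
        openCount (u ++ v) + suc a ∎
        where
        open ≡-Reasoning
        t = tail i a v
        pre = openBefore u v
        after : ∀ u₁ u₂ → u₁ ++ u₂ ≡ i ∷ t → Open (u ++ u₁ , u₂)
        after u₁ u₂ eq = All.map
          (λ i≤j → above-⊆ (suffix-⊆ u₁ eq)
                     (above-filter i≤j (subst (Above _) (sym (filter-inserted [] v>)) λ c d p _ _ → s c d p)))
          (Allₚ.++⁺ (All.map <⇒≤ u>) (Allₚ.++⁻ˡ u₁ (subst (All (i ≤_)) (sym eq) (insert-≥ [] v>))))

      -- Cuts inside u keep their status, and the cut just before i inherits that of the split: this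
      -- is the added 1. Behind i, the test of i implies the tests of all larger letters, which
      -- leaves `aboveCount i`.
      count-unsorted : All (i <_) u → All (i <_) v → ¬ Sorted v → Open (u , v) →
                       openCount (insert i a (u , v)) ≡ suc (openRank (u , v) + extra a)
      count-unsorted {i} {u} {v} {a} u> v> ¬s o = begin
        openCount (insert i a (u , v))
          ≡⟨ count-splits-++ open? u (i ∷ t) ⟩
        openBefore u (i ∷ t) + countAfter open? u (i ∷ t)
          ≡⟨ cong₂ _+_ (openBefore-insert u> v>) (cong length (filter-accept (open? ∘ map₁ (u ++_)) o′)) ⟩
        pre + suc (count (open? ∘ map₁ (u ++_)) (map (map₁ (i ∷_)) (splits t)))
          ≡⟨ cong (λ n → pre + suc n) (trans (count-map (open? ∘ map₁ (u ++_)) (map₁ (i ∷_)) (splits t)) after) ⟩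
        pre + suc (aboveCount i t)
          ≡⟨ cong (λ n → pre + suc n) (above-tail v> ¬s) ⟩
        pre + suc (extra a + sortedCount v)
          ≡⟨ +-suc pre _ ⟩
        suc (pre + (extra a + sortedCount v))
          ≡⟨ cong (λ n → suc (pre + n)) (+-comm (extra a) _) ⟩
        suc (pre + (sortedCount v + extra a))
          ≡⟨ cong suc (+-assoc pre _ _) ⟨
        suc (pre + sortedCount v + extra a)
          ≡⟨ cong (λ n → suc (n + extra a)) (openRank-unsorted ¬s) ⟨
        suc (openRank (u , v) + extra a) ∎
        where
        open ≡-Reasoning
        t = tail i a v
        pre = openBefore u v
        o′ : Open (u ++ [] , i ∷ t)
        o′ = subst (λ w → Open (w , i ∷ t)) (sym (++-identityʳ u)) (Equivalence.to (open-insert u> [] v>) o)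
        after : count (open? ∘ map₁ (u ++_) ∘ map₁ (i ∷_)) (splits t) ≡ aboveCount i t
        after = count-splits-cong (open? ∘ map₁ (u ++_) ∘ map₁ (i ∷_)) (above? i ∘ proj₂) t λ u₁ u₂ eq → mk⇔
          (λ o → case Allₚ.++⁻ʳ u o of λ { (ab ∷ _) → ab })
          (λ ab → All.map (λ i≤j c d p j<c j<d → ab c d p (≤-<-trans i≤j j<c) (≤-<-trans i≤j j<d))
            (Allₚ.++⁺ (All.map <⇒≤ u>) (≤-refl ∷ Allₚ.++⁻ˡ u₁ (subst (All (i ≤_)) (sym eq) (tail-≥ v>)))))

      av-insert⁺ : All (i <_) u → All (i <_) v → Avoids21⊕ S (u ++ v) → Open (u , v) → Avoids21⊕ S (insert i a (u , v))
      av-insert⁺ u> v> av o {b = b} {c} {d} a<b b<c b<d p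
        with i≤b ∷ i≤a ∷ _ ← All-resp-⊆ p (insert-≥ u> v>) with m≤n⇒m<n∨m≡n i≤a
      ... | inj₁ i<a =
        let i<b = <-trans i<a a<b
        in av a<b b<c b<d (large-⊆ u> v> (i<b ∷ i<a ∷ <-trans i<b b<c ∷ <-trans i<b b<d ∷ []) p)
      ... | inj₂ refl with before-least u> a<b p
      ...   | inj₁ (b∈u , q) = All.lookup o b∈u c d (large-⊆-tail v> (<-trans a<b b<c ∷ <-trans a<b b<d ∷ []) q) b<c b<d
      -- Here the 1 is a further copy of i. Within the tail it has no larger letter before it for
      -- 121, and none behind it for 112.
      ...   | inj₂ q = contradiction (⊆-trans (refl ∷ refl ∷ refl ∷ minimum _) q) (tail-pattern v> a<b (<-trans a<b b<c))

      av-insert⁻ : All (i <_) u → All (i <_) v → Avoids21⊕ S (insert i a (u , v)) → Avoids21⊕ S (u ++ v) × Open (u , v)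
      av-insert⁻ {u = u} u> v> av =
        (λ a<b b<c b<d p → av a<b b<c b<d (⊆-trans p (⊆-insert u> v>))) ,
        All.tabulate λ j∈u c d p j<c j<d →
          av (All.lookup u> j∈u) j<c j<d (++⁺ (from∈ j∈u) (refl ∷ ⊆-trans p (⊆-tail v>)))

-- Generating trees

concatMap-cong-↭ : (f g : A → List B) → ∀ {xs} → All (λ x → f x ↭ g x) xs → concatMap f xs ↭ concatMap g xs
concatMap-cong-↭ f g []       = ↭-refl
concatMap-cong-↭ f g (p ∷ ps) = Permₚ.++⁺ p (concatMap-cong-↭ f g ps)

concatMap-↭ : (f : A → List B) → ∀ {xs ys} → xs ↭ ys → concatMap f xs ↭ concatMap f ys
concatMap-↭ f Perm.refl          = ↭-refl
concatMap-↭ f (Perm.prep x p)    = Permₚ.++⁺ˡ (f x) (concatMap-↭ f p)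
concatMap-↭ f (Perm.swap x y p)  = ↭-trans (Permₚ.shifts (f x) (f y))
  (Permₚ.++⁺ˡ (f y) (Permₚ.++⁺ˡ (f x) (concatMap-↭ f p)))
concatMap-↭ f (Perm.trans p q)   = ↭-trans (concatMap-↭ f p) (concatMap-↭ f q)

map-unique : (f : A → B) → ∀ {xs} → (∀ {x y} → x ∈ xs → y ∈ xs → f x ≡ f y → x ≡ y) → Unique xs → Unique (map f xs)
map-unique f inj []       = []
map-unique f inj (x∉ ∷ u) =
  Allₚ.map⁺ (All.tabulate λ y∈ eq → All.lookup x∉ y∈ (inj (here refl) (there y∈) eq)) ∷
  map-unique f (λ x∈ y∈ → inj (there x∈) (there y∈)) u

-- Since `parent` recovers the element from which a value was produced, different elements
-- contribute disjoint lists.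
concatMap-unique : (f : A → List B) (parent : B → A) → ∀ {xs} → (∀ {x y} → x ∈ xs → y ∈ f x → parent y ≡ x) →
                   (∀ {x} → x ∈ xs → Unique (f x)) → Unique xs → Unique (concatMap f xs)
concatMap-unique f parent par uf []       = []
concatMap-unique f parent par uf (x∉ ∷ u) = Uniqueₚ.++⁺ (uf (here refl))
  (concatMap-unique f parent (par ∘ there) (uf ∘ there) u)
  λ (y∈fx , y∈rest) → case find (∈-concatMap⁻ f y∈rest) of λ (x′ , x′∈ , y∈fx′) →
    All.lookup x∉ x′∈ (trans (sym (par (here refl) y∈fx)) (par (there x′∈) y∈fx′))

splits-unique : ∀ w → Unique (splits w)
splits-unique []      = [] ∷ []
splits-unique (x ∷ w) =
  Allₚ.map⁺ (All.universal (λ _ ()) (splits w)) ∷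
  Uniqueₚ.map⁺ (λ eq → cong₂ _,_ (∷-injectiveʳ (cong proj₁ eq)) (cong proj₂ eq)) (splits-unique w)

-- Multiplicities and removal of the least letter

occurrences-≡ : ∀ j w → occurrences j (j ∷ w) ≡ suc (occurrences j w)
occurrences-≡ j w = cong length (filter-accept (j ≟_) refl)

occurrences-≢ : ∀ {j x} w → j ≢ x → occurrences j (x ∷ w) ≡ occurrences j w
occurrences-≢ {j} w j≢x = cong length (filter-reject (j ≟_) j≢x)

occurrences-filter : i < j → ∀ w → occurrences j (filter (i <?_) w) ≡ occurrences j w
occurrences-filter         i<j []      = refl
occurrences-filter {i} {j} i<j (x ∷ w) with i <? x
... | no  i≮x = trans (trans (cong (occurrences j) (filter-reject (i <?_) i≮x)) (occurrences-filter i<j w))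
                      (sym (occurrences-≢ w λ { refl → i≮x i<j }))
... | yes i<x = trans (cong (occurrences j) (filter-accept (i <?_) i<x)) (case j ≟ x of λ
  { (yes refl) → trans (occurrences-≡ j _) (trans (cong suc (occurrences-filter i<j w)) (sym (occurrences-≡ j w)))
  ; (no j≢x)   → trans (occurrences-≢ _ j≢x) (trans (occurrences-filter i<j w) (sym (occurrences-≢ w j≢x))) })

-- An entry a of the list stands for multiplicity 1 + a.
HasMultiplicities : ℕ → List ℕ → Word → Set
HasMultiplicities i []       w = w ≡ []
HasMultiplicities i (a ∷ as) w =
  All (i ≤_) w × occurrences i w ≡ suc a × HasMultiplicities (suc i) as (filter (i <?_) w)

hasMultiplicities-≥ : ∀ as → HasMultiplicities i as w → All (i ≤_) w
hasMultiplicities-≥ []       refl    = []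
hasMultiplicities-≥ (_ ∷ as) (w≥ , _) = w≥

-- Replaces the simultaneous count of all letters by the recursion that erases the least one, which
-- is how the tree undoes insertions.
hasMultiplicities⇔ : ∀ {k} i (m : Fin k → ℕ) w →
  ((∀ j → occurrences (i + toℕ j) w ≡ suc (m j)) × All (λ x → i ≤ x × x < i + k) w) ⇔
  HasMultiplicities i (tabulate m) w
hasMultiplicities⇔ {zero} i m []      = mk⇔ (λ _ → refl) (λ _ → (λ ()) , [])
hasMultiplicities⇔ {zero} i m (x ∷ w) = mk⇔
  (λ { (_ , (i≤x , x<i) ∷ _) → contradiction (≤-trans x<i (≤-trans (≤-reflexive (+-identityʳ i)) i≤x)) (<-irrefl refl) })
  (λ ())
hasMultiplicities⇔ {suc k} i m w = mk⇔
  (λ (occ , bounds) → All.map proj₁ bounds , trans (cong (λ j → occurrences j w) (sym (+-identityʳ i))) (occ zero) ,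
    Equivalence.to IH
      ( (λ j → trans (sym (occ-suc j)) (occ (suc j)))
      , All.zipWith (λ ((_ , x<) , i<x) → i<x , <-≤-trans x< (≤-reflexive (+-suc i k)))
          (All-resp-⊆ (filter-⊆ (i <?_) w) bounds , Allₚ.all-filter (i <?_) w)))
  (λ (w≥ , occ₀ , mults) → let occ , bounds = Equivalence.from IH mults in
    (λ { zero    → trans (cong (λ j → occurrences j w) (+-identityʳ i)) occ₀
       ; (suc j) → trans (occ-suc j) (occ j) }) ,
    All.tabulate λ x∈w → let i≤x = All.lookup w≥ x∈w in i≤x , (case m≤n⇒m<n∨m≡n i≤x of λ
      { (inj₁ i<x)  → <-≤-trans (proj₂ (All.lookup bounds (∈-filter⁺ (i <?_) x∈w i<x))) (≤-reflexive (sym (+-suc i k)))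
      ; (inj₂ refl) → m<m+n i z<s }))
  where
  IH = hasMultiplicities⇔ (suc i) (m ∘ suc) (filter (i <?_) w)
  occ-suc : ∀ (j : Fin k) → occurrences (i + suc (toℕ j)) w ≡ occurrences (suc i + toℕ j) (filter (i <?_) w)
  occ-suc j = trans (cong (λ n → occurrences n w) (+-suc i (toℕ j)))
                    (sym (occurrences-filter (s≤s (m≤m+n i (toℕ j))) w))

-- The first i marks the end of u, so a child determines the split at which it arose.
first-least-injective : ∀ {u u′ t t′} → All (i <_) u → All (i <_) u′ → u ++ i ∷ t ≡ u′ ++ i ∷ t′ → u ≡ u′
first-least-injective []        []        eq   = refl
first-least-injective []        (i<i ∷ _) refl = contradiction i<i (<-irrefl refl)
first-least-injective (i<i ∷ _) []        refl = contradiction i<i (<-irrefl refl)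
first-least-injective (_ ∷ u>)  (_ ∷ u′>) eq   =
  cong₂ _∷_ (∷-injectiveˡ eq) (first-least-injective u> u′> (∷-injectiveʳ eq))

-- Levels of the tree as lists of states

State : Set
State = ℕ × ℕ

module Generation (S : Rel) (S? : ∀ x y → Dec (S x y)) (sch : Insertion.Scheme S S?) where
  open Order S S?
  open Insertion S S?
  open Scheme sch
  open Insert sch

  -- A rank below q belongs to a right part avoiding σ and equals its length, which is why it can be
  -- passed to `qSorted`.
  step : ℕ → State → ℕ → State
  step a (p , q) r with r <? q
  ... | yes _ = p + suc a , qSorted r a q
  ... | no  _ = suc (r + extra a) , qUnsorted a q

  -- Depends on the scheme but on no `Track`: here the cases 12⊕σ and 21⊕σ become one.
  states : List ℕ → List State
  states []       = [ 1 , sortedCount [] ]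
  states (a ∷ as) = concatMap (λ s → map (step a s) (downFrom (proj₁ s))) (states as)

  module _ (tr : Track) where
    open Track tr

    children : ℕ → ℕ → Word → List Word
    children i a w = map (insert i a) (filter ok? (splits w))

    generated : ℕ → List ℕ → List Word
    generated i []       = [ [] ]
    generated i (a ∷ as) = concatMap (children i a) (generated (suc i) as)

    state : Word → State
    state w = okCount w , sortedCount w

    state-insert : All (i <_) u → All (i <_) v → Ok (u , v) →
                   state (insert i a (u , v)) ≡ step a (state (u ++ v)) (rank (u , v))
    state-insert {i} {u} {v} {a} u> v> ok with sorted? v | rank (u , v) <? sortedCount (u ++ v)
    ... | yes s | yes _  = cong₂ _,_ (count-sorted u> v> s) (trans (sorted-insert u> v> s)
                             (cong (λ r → qSorted r a (sortedCount (u ++ v))) (sym (rank-sorted s))))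
    -- The mixed cases are impossible: the rank is below q exactly when v avoids σ.
    ... | yes s | no r≮q = contradiction
      (≤-trans (≤-reflexive (cong suc (rank-sorted s))) (SortedSuffix.suffixCount-> u s)) r≮q
    ... | no ¬s | yes r<q = contradiction r<q (≤⇒≯ (rank-unsorted ¬s))
    ... | no ¬s | no _   = cong₂ _,_ (count-unsorted u> v> ¬s ok)
      (trans (SortedSuffix.suffixCount-¬ u ¬s-tail) (trans (SortedSuffix.suffixCount-¬∷ ¬s-tail)
        (trans (sorted-tail v> ¬s) (cong (qUnsorted a) (sym (SortedSuffix.suffixCount-¬ u ¬s))))))
      where
      ¬s-tail : ¬ Sorted (i ∷ tail i a v)
      ¬s-tail = ¬s ∘ sorted-⊆ (i ∷ʳ ⊆-tail v>)

    child : ∀ {w s} → All (i <_) w → s ∈ filter ok? (splits w) →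
            proj₁ s ++ proj₂ s ≡ w × All (i <_) (proj₁ s) × All (i <_) (proj₂ s) × Ok s
    child {i} {w} {u , v} w> s∈ with s∈′ , ok ← ∈-filter⁻ ok? {xs = splits w} s∈ with refl ← ∈-splits⁻ w s∈′ =
      refl , Allₚ.++⁻ˡ u w> , Allₚ.++⁻ʳ u w> , ok

    children-states : All (i <_) w → map state (children i a w) ↭ map (step a (state w)) (downFrom (okCount w))
    children-states {i} {w} {a} w> = ↭-trans (↭-reflexive (begin
      map state (map (insert i a) sites)   ≡⟨ map-∘ sites ⟨
      map (state ∘ insert i a) sites       ≡⟨ map-cong-local (All.tabulate λ s∈ →
        let eq , u> , v> , ok = child w> s∈ in
        trans (state-insert u> v> ok) (cong (λ w → step a (state w) (rank _)) eq)) ⟩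
      map (step a (state w) ∘ rank) sites  ≡⟨ map-∘ sites ⟩
      map (step a (state w)) (map rank sites) ∎)) (Permₚ.map⁺ _ (ranks w))
      where
      open ≡-Reasoning
      sites = filter ok? (splits w)

    ∈-generated⁻ : ∀ as → w ∈ generated i as → HasMultiplicities i as w × Base w × Av w
    ∈-generated⁻ []       (here refl) = refl , base-[] , av-[]
    ∈-generated⁻ {w} {i} (a ∷ as) w∈ with find (∈-concatMap⁻ (children i a) w∈)
    ... | w′ , w′∈ , w∈c with mult , base , av ← ∈-generated⁻ as w′∈
                         with (u , v) , s∈ , refl ← ∈-map⁻ (insert i a) w∈c
                         with refl , u> , v> , ok ← child (hasMultiplicities-≥ as mult) s∈ =
      ( insert-≥ u> v>
      , occ u>
      , subst (HasMultiplicities (suc i) as) (sym (filter-inserted u> v>)) mult)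
      , base-insert u> v> base , av-insert⁺ u> v> av ok
      where
      occ : ∀ {u} → All (i <_) u → occurrences i (u ++ i ∷ tail i a v) ≡ suc a
      occ []         = trans (occurrences-≡ i _) (cong suc (occurrences-tail v>))
      occ (i<x ∷ u>) = trans (occurrences-≢ _ (<⇒≢ i<x)) (occ u>)

    ∈-generated⁺ : ∀ as → HasMultiplicities i as w → Base w → Av w → w ∈ generated i as
    ∈-generated⁺ []       refl _ _ = here refl
    ∈-generated⁺ {i} {w} (a ∷ as) (w≥ , occ , mult) base av
      with u , v , u> , v> , refl ← base-decompose w≥ occ base
      with av′ , ok ← av-insert⁻ u> v> av =
      ∈-concatMap⁺ (children i a) (lose
        (∈-generated⁺ as (subst (HasMultiplicities (suc i) as) (filter-inserted u> v>) mult)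
                      (base-⊆ (⊆-insert u> v>) base) av′)
        (∈-map⁺ (insert i a) (∈-filter⁺ ok? (∈-splits⁺ u v) ok)))

    generated-≥ : ∀ as → w ∈ generated i as → All (i ≤_) w
    generated-≥ as = hasMultiplicities-≥ as ∘ proj₁ ∘ ∈-generated⁻ as

    generated-unique : ∀ i as → Unique (generated i as)
    generated-unique i []       = [] ∷ []
    -- Erasing the copies of i returns the parent word.
    generated-unique i (a ∷ as) = concatMap-unique (children i a) (filter (i <?_))
      (λ w∈ y∈ → case ∈-map⁻ (insert i a) y∈ of λ { (s , s∈ , refl) →
         let eq , u> , v> , _ = child (generated-≥ as w∈) s∈ in trans (filter-inserted u> v>) eq })
      (λ {w} w∈ → map-unique (insert i a)
         (λ {s} {s′} s∈ s′∈ eq →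
           let e  , u>  , _ = child (generated-≥ as w∈) s∈
               e′ , u′> , _ = child (generated-≥ as w∈) s′∈
           in same-split s s′ (first-least-injective u> u′> eq) (trans e (sym e′)))
         (Uniqueₚ.filter⁺ ok? (splits-unique w)))
      (generated-unique (suc i) as)
      where
      same-split : (s s′ : Site) → proj₁ s ≡ proj₁ s′ → proj₁ s ++ proj₂ s ≡ proj₁ s′ ++ proj₂ s′ → s ≡ s′
      same-split (u , v) (.u , v′) refl eq = cong (u ,_) (++-cancelˡ u v v′ eq)

    generated-states : ∀ i as → map state (generated i as) ↭ states as
    generated-states i []       = ↭-reflexive (cong (λ p → [ p , sortedCount [] ]) okCount-[])
    generated-states i (a ∷ as) = ↭-trans (↭-reflexive (map-concatMap state (children i a) (generated (suc i) as)))
      (↭-trans (concatMap-cong-↭ _ (next ∘ state) (All.tabulate λ w∈ → children-states (generated-≥ as w∈)))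
      (↭-trans (↭-reflexive (sym (concatMap-map next state (generated (suc i) as))))
               (concatMap-↭ next (generated-states (suc i) as))))
      where
      next : State → List State
      next s = map (step a s) (downFrom (proj₁ s))

    -- The avoiders and the generated words are two lists without repetition and with the same
    -- members, hence equally long. The resulting number is the same for every track of the scheme.
    av-states : ∀ {P} → (∀ w → AvoidsAll P w ⇔ (Base w × Av w)) →
                ∀ M → av M P ≡ length (states (tabulate (pred ∘ Multiset.mult M)))
    av-states {P} P⇔ M = begin
      av M P                               ≡⟨ Permₚ.↭-length (∼bag⇒↭ (unique∧set⇒bag
        (Uniqueₚ.filter⁺ (avoidsAll? P) (multipermutations-unique M)) (generated-unique 1 ms)
        (mk⇔ to from))) ⟩
      length (generated 1 ms)              ≡⟨ length-map state (generated 1 ms) ⟨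
      length (map state (generated 1 ms))  ≡⟨ Permₚ.↭-length (generated-states 1 ms) ⟩
      length (states ms)                   ∎
      where
      open ≡-Reasoning
      open Multiset M
      ms = tabulate (pred ∘ mult)

      suc-pred-mult : ∀ j → suc (pred (mult j)) ≡ mult j
      suc-pred-mult j with mult j | mult≥1 j
      ... | suc _ | _ = refl

      to : w ∈ filter (avoidsAll? P) (multipermutations M) → w ∈ generated 1 ms
      to {w} w∈ with w∈M , avoids ← ∈-filter⁻ (avoidsAll? P) {xs = multipermutations M} w∈
                with occ , bounds ← multipermutations-sound M w∈M
                with base , av ← Equivalence.to (P⇔ w) avoids =
        ∈-generated⁺ ms (Equivalence.to (hasMultiplicities⇔ 1 (pred ∘ mult) w)
          ((λ j → trans (occ j) (sym (suc-pred-mult j))) , All.map (λ (1≤x , x≤k) → 1≤x , s≤s x≤k) bounds)) base av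

      from : w ∈ generated 1 ms → w ∈ filter (avoidsAll? P) (multipermutations M)
      from {w} w∈ with mults , base , av ← ∈-generated⁻ ms w∈
                  with occ , bounds ← Equivalence.from (hasMultiplicities⇔ 1 (pred ∘ mult) w) mults =
        ∈-filter⁺ (avoidsAll? P)
          (multipermutations-complete M
            ((λ j → trans (occ j) (suc-pred-mult j)) , All.map (λ (1≤x , x<) → 1≤x , ≤-pred x<) bounds))
          (Equivalence.from (P⇔ w) (base , av))

replicate-< : ∀ a → i < b → ¬ b ∷ [] ⊆ replicate a i
replicate-< {i} a i<b p with b≡i ∷ [] ← All-resp-⊆ p (Allₚ.replicate⁺ {P = _≡ i} a refl) = <-irrefl (sym b≡i) i<b

filter-replicate : ∀ i a → filter (i <?_) (replicate a i) ≡ []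
filter-replicate i a = filter-none (i <?_) (Allₚ.replicate⁺ a (<-irrefl refl))

occurrences-replicate : ∀ i a → occurrences i (replicate a i) ≡ a
occurrences-replicate i a = trans (cong length (filter-all (i ≟_) (Allₚ.replicate⁺ a refl))) (length-replicate a)

occurrences-++ : ∀ i u v → occurrences i (u ++ v) ≡ occurrences i u + occurrences i v
occurrences-++ i = count-++ (i ≟_)

occurrences-absent : All (i <_) v → occurrences i v ≡ 0
occurrences-absent {i} v> = count-none (i ≟_) (All.map <⇒≢ v>)

-- The schemes for 121 and 112

split-first : ∀ w → All (i ≤_) w → occurrences i w ≡ suc a →
              ∃₂ λ u t → All (i <_) u × All (i ≤_) t × occurrences i t ≡ a × w ≡ u ++ i ∷ t
split-first []      []         ()
split-first {i} (x ∷ w) (i≤x ∷ w≥) occ with m≤n⇒m<n∨m≡n i≤x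
... | inj₂ refl = [] , w , [] , w≥ , suc-injective (trans (sym (occurrences-≡ i w)) occ) , refl
... | inj₁ i<x with u , t , u> , t≥ , occ′ , refl ← split-first w w≥ (trans (sym (occurrences-≢ w (<⇒≢ i<x))) occ) =
  x ∷ u , t , i<x ∷ u> , t≥ , occ′ , refl

without-least : All (i ≤_) w → ¬ i ∈ w → All (i <_) w
without-least w≥ i∉w = All.tabulate λ x∈w → ≤∧≢⇒< (All.lookup w≥ x∈w) λ { refl → i∉w x∈w }

only-least : All (i ≤_) w → (∀ {x} → x ∈ w → ¬ i < x) → All (i ≡_) w
only-least w≥ none = All.tabulate λ x∈w → ≤-antisym (All.lookup w≥ x∈w) (≮⇒≥ (none x∈w))

module Block where

  block : ℕ → ℕ → Word → Word
  block i a v = replicate a i ++ v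

  no-larger-before : All (i <_) v → i < b → ∀ a → ¬ b ∷ i ∷ [] ⊆ block i a v
  no-larger-before v> i<b zero    p with _ ∷ i<i ∷ [] ← All-resp-⊆ p v> = <-irrefl refl i<i
  no-larger-before v> i<b (suc a) (_ ∷ʳ p)   = no-larger-before v> i<b a p
  no-larger-before v> i<b (suc a) (refl ∷ p) = <-irrefl refl i<b

  filter-block : ∀ a → All (i <_) v → filter (i <?_) (block i a v) ≡ v
  filter-block {i} {v} a v> = trans (filter-++ (i <?_) (replicate a i) v)
    (cong₂ _++_ (filter-replicate i a) (filter-all (i <?_) v>))

  decompose : ∀ t → All (i ≤_) t → occurrences i t ≡ a → (∀ {y} → i < y → ¬ y ∷ i ∷ [] ⊆ t) →
              ∃ λ v → All (i <_) v × t ≡ block i a v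
  decompose []      []         refl none = [] , [] , refl
  decompose {i} {a} (x ∷ t) (i≤x ∷ t≥) occ none with m≤n⇒m<n∨m≡n i≤x
  ... | inj₁ i<x with all> ← without-least t≥ (λ i∈t → none i<x (refl ∷ from∈ i∈t))
        with refl ← trans (sym occ) (occurrences-absent (i<x ∷ all>)) = x ∷ t , i<x ∷ all> , refl
  decompose {i} {a} (x ∷ t) (i≤x ∷ t≥) occ none | inj₂ refl with refl ← trans (sym occ) (occurrences-≡ i t)
    with v , v> , eq ← decompose t t≥ refl (λ i<y p → none i<y (i ∷ʳ p)) = v , v> , cong (i ∷_) eq

  base-insert : All (i <_) u → All (i <_) v → Avoids121 (u ++ v) → Avoids121 (u ++ i ∷ block i a v)
  base-insert {a = a} u> v> av x<y p
    with i≤x ∷ _ ← All-resp-⊆ p (Allₚ.++⁺ (All.map <⇒≤ u>) (≤-refl ∷ Allₚ.++⁺ (Allₚ.replicate⁺ a ≤-refl) (All.map <⇒≤ v>)))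
    with m≤n⇒m<n∨m≡n i≤x
  ... | inj₁ i<x  = av x<y (large-insert u> (filter-block a v>) (i<x ∷ <-trans i<x x<y ∷ i<x ∷ []) p)
  ... | inj₂ refl = no-larger-before v> x<y a (after-least u> p)

  -- A larger letter between two copies of i would form 121 with them, so the copies of the least
  -- letter are consecutive.
  base-decompose : All (i ≤_) w → occurrences i w ≡ suc a → Avoids121 w →
                   ∃₂ λ u v → All (i <_) u × All (i <_) v × w ≡ u ++ i ∷ block i a v
  base-decompose {w = w} w≥ occ av with u , t , u> , t≥ , occ′ , refl ← split-first w w≥ occ
    with v , v> , refl ← decompose t t≥ occ′ (λ i<y p → av i<y (++⁺ˡ u (refl ∷ p))) =
    u , v , u> , v> , refl

  module _ (S : Rel) (S? : ∀ x y → Dec (S x y)) where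
    open Order S S?

    -- Each copy of i in front of v is the 1 of a copy of 1⊕σ, so no cut before such a copy counts.
    tri-block : All (i <_) v → ¬ Sorted v → Tri v → ∀ a → triCount (block i a v) ≡ suc (length v)
    tri-block         v> ¬s tri zero    = TriSuffix.suffixCount-all tri
    tri-block {v = v} v> ¬s tri (suc a) = trans
      (TriSuffix.suffixCount-¬∷ λ h → ¬s (Equivalence.to (above⇔sorted v>)
        λ c d p → h _ c d (refl ∷ ++⁺ˡ (replicate a _) p)))
      (tri-block v> ¬s tri a)

    scheme : (qSorted : ℕ → ℕ → ℕ → ℕ) →
             (∀ {i a u v} → All (i <_) u → All (i <_) v → Sorted v →
               sortedCount (u ++ i ∷ block i a v) ≡ qSorted (length v) a (sortedCount (u ++ v))) →
             Insertion.Scheme S S?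
    scheme qSorted sorted-insert = record
      { Base             = Avoids121
      ; tail             = block
      ; base-[]          = λ _ ()
      ; base-⊆           = λ u⊆v av x<y p → av x<y (⊆-trans p u⊆v)
      ; base-insert      = λ {i} {u} {v} {a} → base-insert {a = a}
      ; base-decompose   = base-decompose
      ; filter-tail      = λ {i} {v} {a} → filter-block a
      ; tail-≥           = λ {i} {v} {a} v> → Allₚ.++⁺ (Allₚ.replicate⁺ a ≤-refl) (All.map <⇒≤ v>)
      ; length-tail      = λ {i} {a} {v} → trans (length-++ (replicate a i) {v}) (cong (_+ length v) (length-replicate a))
      ; occurrences-tail = λ {i} {v} {a} v> → trans (occurrences-++ i (replicate a i) v)
          (trans (cong₂ _+_ (occurrences-replicate i a) (occurrences-absent v>)) (+-identityʳ a))
      ; tail-pattern     = λ {i} {v} {b} {c} {a} v> i<b _ p →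
          no-larger-before v> i<b a (⊆-trans (refl ∷ refl ∷ minimum _) p)
      ; extra            = λ _ → 0
      ; qUnsorted        = λ _ q → q
      ; qSorted          = qSorted
      ; tri-tail         = λ {i} {v} {a} v> ¬s tri → tri-block v> ¬s tri a
      ; above-tail       = λ {i} {v} {a} v> ¬s → trans
          (AboveSuffix.suffixCount-¬ i (replicate a i) (¬s ∘ Equivalence.to (above⇔sorted v>)))
          (count-splits-cong (above? i ∘ proj₂) (sorted? ∘ proj₂) v λ u₁ u₂ eq →
            above⇔sorted (Allₚ.++⁻ʳ u₁ (subst (All (i <_)) (sym eq) v>)))
      ; sorted-tail      = λ {i} {v} {a} v> ¬s → SortedSuffix.suffixCount-¬ (replicate a i) ¬s
      ; sorted-insert    = sorted-insert
      }

module Trailing where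

  trailing : ℕ → ℕ → Word → Word
  trailing i a v = v ++ replicate a i

  no-larger-after : All (i <_) v → i < b → ∀ a → ¬ i ∷ b ∷ [] ⊆ trailing i a v
  no-larger-after []         i<b a p          = replicate-< a i<b (∷ˡ⁻ p)
  no-larger-after (_ ∷ v>)   i<b a (_ ∷ʳ p)   = no-larger-after v> i<b a p
  no-larger-after (i<i ∷ _)  i<b a (refl ∷ p) = <-irrefl refl i<i

  filter-trailing : ∀ a → All (i <_) v → filter (i <?_) (trailing i a v) ≡ v
  filter-trailing {i} {v} a v> = trans (filter-++ (i <?_) v (replicate a i))
    (trans (cong₂ _++_ (filter-all (i <?_) v>) (filter-replicate i a)) (++-identityʳ v))

  trailing-≥ : ∀ a → All (i <_) v → All (i ≤_) (trailing i a v)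
  trailing-≥ a v> = Allₚ.++⁺ (All.map <⇒≤ v>) (Allₚ.replicate⁺ a ≤-refl)

  decompose : ∀ t → All (i ≤_) t → occurrences i t ≡ a → (∀ {y} → i < y → ¬ i ∷ y ∷ [] ⊆ t) →
              ∃ λ v → All (i <_) v × t ≡ trailing i a v
  decompose []      []         refl none = [] , [] , refl
  decompose {i} {a} (x ∷ t) (i≤x ∷ t≥) occ none with m≤n⇒m<n∨m≡n i≤x
  ... | inj₁ i<x with v , v> , refl ← decompose t t≥ (trans (sym (occurrences-≢ t (<⇒≢ i<x))) occ) (λ i<y p → none i<y (x ∷ʳ p)) =
    x ∷ v , i<x ∷ v> , refl
  ... | inj₂ refl with all≡ ← only-least t≥ (λ y∈t i<y → none i<y (refl ∷ from∈ y∈t))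
        with refl ← trans (sym occ) (cong length (filter-all (i ≟_) (refl ∷ all≡))) =
    [] , [] , cong (i ∷_) (constant t all≡)
    where
    constant : ∀ t → All (i ≡_) t → t ≡ replicate (length t) i
    constant []      []            = refl
    constant (_ ∷ t) (refl ∷ all≡) = cong (i ∷_) (constant t all≡)

  base-insert : All (i <_) u → All (i <_) v → Avoids112 (u ++ v) → Avoids112 (u ++ i ∷ trailing i a v)
  base-insert {a = a} u> v> av x<y p
    with i≤x ∷ _ ← All-resp-⊆ p (Allₚ.++⁺ (All.map <⇒≤ u>) (≤-refl ∷ trailing-≥ a v>))
    with m≤n⇒m<n∨m≡n i≤x
  ... | inj₁ i<x  = av x<y (large-insert u> (filter-trailing a v>) (i<x ∷ i<x ∷ <-trans i<x x<y ∷ []) p)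
  ... | inj₂ refl = no-larger-after v> x<y a (after-least u> p)

  -- A larger letter behind the second i would complete 112, so all copies of i but the first stand
  -- at the end.
  base-decompose : All (i ≤_) w → occurrences i w ≡ suc a → Avoids112 w →
                   ∃₂ λ u v → All (i <_) u × All (i <_) v × w ≡ u ++ i ∷ trailing i a v
  base-decompose {w = w} w≥ occ av with u , t , u> , t≥ , occ′ , refl ← split-first w w≥ occ
    with v , v> , refl ← decompose t t≥ occ′ (λ i<y p → av i<y (++⁺ˡ u (refl ∷ p))) =
    u , v , u> , v> , refl

  module _ (S : Rel) (S? : ∀ x y → Dec (S x y)) where
    open Order S S?

    -- A trailing i has nothing larger behind it and cannot be the 1 of 1⊕σ.
    tri-trailing : All (i <_) v → Tri v → Tri (trailing i a v)
    tri-trailing {a = a} v> tri b c d p b<c b<d with i≤b ∷ _ ← All-resp-⊆ p (trailing-≥ a v>) with m≤n⇒m<n∨m≡n i≤b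
    ... | inj₁ i<b  = tri b c d (⊆-trans (⊆-filter (i<b ∷ <-trans i<b b<c ∷ <-trans i<b b<d ∷ []) p)
                                         (⊆-reflexive (filter-trailing a v>))) b<c b<d
    ... | inj₂ refl = contradiction (⊆-trans (refl ∷ refl ∷ minimum _) p) (no-larger-after v> b<c a)

    -- The test of i does not see the trailing copies of i; they only contribute a more cuts.
    above-trailing : All (i <_) v → aboveCount i (trailing i a v) ≡ a + sortedCount v
    above-trailing {i} {v} {a} v> = begin
      aboveCount i (v ++ replicate a i)
        ≡⟨ count-splits-++ (above? i ∘ proj₂) v (replicate a i) ⟩
      count (above? i ∘ proj₂) (splitsBefore v (replicate a i)) + aboveCount i (replicate a i)
        ≡⟨ cong₂ _+_ before (AboveSuffix.suffixCount-all i λ c d p i<c → contradiction (⊆-trans (refl ∷ minimum _) p) (replicate-< a i<c)) ⟩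
      pre + suc (length (replicate a i))
        ≡⟨ cong (λ n → pre + suc n) (length-replicate a) ⟩
      pre + suc a
        ≡⟨ trans (+-comm pre (suc a)) (sym (+-suc a pre)) ⟩
      a + suc pre
        ≡⟨ cong (a +_) (+-comm 1 pre) ⟩
      a + (pre + 1)
        ≡⟨ cong (λ n → a + (pre + n)) (SortedSuffix.suffixCount-all {w = []} λ _ _ ()) ⟨
      a + (pre + sortedCount [])
        ≡⟨ cong (a +_) (count-splits-++ (sorted? ∘ proj₂) v []) ⟨
      a + sortedCount (v ++ [])
        ≡⟨ cong (λ w → a + sortedCount w) (++-identityʳ v) ⟩
      a + sortedCount v ∎
      where
      open ≡-Reasoning
      pre = count (sorted? ∘ proj₂) (splitsBefore v [])
      before : count (above? i ∘ proj₂) (splitsBefore v (replicate a i)) ≡ pre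
      before = countBefore-cong (above? i ∘ proj₂) (sorted? ∘ proj₂) v λ u₁ x u₂ eq →
        let u₂> = Allₚ.++⁻ʳ u₁ (subst (All (i <_)) (sym eq) v>) in mk⇔
          (λ ab → Equivalence.to (above⇔sorted (Allₚ.++⁺ u₂> [])) (above-⊆ (++⁺ (⊆-refl {x = x ∷ u₂}) (minimum _)) ab))
          (λ s → above-filter ≤-refl (subst (Above i) (sym (filter-trailing a u₂>))
            (λ c d p _ _ → s c d (⊆-trans p (++⁺ʳ [] ⊆-refl)))))

    scheme : (qUnsorted : ℕ → ℕ → ℕ) (qSorted : ℕ → ℕ → ℕ → ℕ) →
             (∀ {i a v} → All (i <_) v → ¬ Sorted v → sortedCount (trailing i a v) ≡ qUnsorted a (sortedCount v)) →
             (∀ {i a u v} → All (i <_) u → All (i <_) v → Sorted v →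
               sortedCount (u ++ i ∷ trailing i a v) ≡ qSorted (length v) a (sortedCount (u ++ v))) →
             Insertion.Scheme S S?
    scheme qUnsorted qSorted sorted-tail sorted-insert = record
      { Base             = Avoids112
      ; tail             = trailing
      ; base-[]          = λ _ ()
      ; base-⊆           = λ u⊆v av x<y p → av x<y (⊆-trans p u⊆v)
      ; base-insert      = λ {i} {u} {v} {a} → base-insert {a = a}
      ; base-decompose   = base-decompose
      ; filter-tail      = λ {i} {v} {a} → filter-trailing a
      ; tail-≥           = λ {i} {v} {a} → trailing-≥ a
      ; length-tail      = λ {i} {a} {v} → length-trailing i a v
      ; occurrences-tail = λ {i} {v} {a} v> → trans (occurrences-++ i v (replicate a i))
          (cong₂ _+_ (occurrences-absent v>) (occurrences-replicate i a))
      ; tail-pattern     = λ {i} {v} {b} {c} {a} v> _ i<c p → no-larger-after v> i<c a (∷ˡ⁻ p)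
      ; extra            = λ a → a
      ; qUnsorted        = qUnsorted
      ; qSorted          = qSorted
      ; tri-tail         = λ {i} {v} {a} v> _ tri → trans (TriSuffix.suffixCount-all (tri-trailing {a = a} v> tri))
          (trans (cong suc (length-trailing i a v)) (sym (+-suc a (length v))))
      ; above-tail       = λ {i} {v} {a} v> _ → above-trailing {a = a} v>
      ; sorted-tail      = sorted-tail
      ; sorted-insert    = sorted-insert
      }
      where
      length-trailing : ∀ i a v → length (trailing i a v) ≡ a + length v
      length-trailing i a v = trans (length-++ v) (trans (cong (length v +_) (length-replicate a)) (+-comm (length v) a))

-- Transitions of q for σ = 21 and for σ = 12

module WeaklyIncreasing where
  open Order _≤_ _≤?_

  unsorted-least : ∀ {x} → i < x → i ∈ v → ¬ Sorted (x ∷ v)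
  unsorted-least i<x i∈v s = <⇒≱ i<x (s _ _ (refl ∷ from∈ i∈v))

  -- Every letter of u exceeds the i that follows it, so no right part starting inside u is weakly
  -- increasing.
  sortedCount-++ : ∀ u → All (i <_) u → i ∈ v → sortedCount (u ++ v) ≡ sortedCount v
  sortedCount-++ []      []         i∈v = refl
  sortedCount-++ (x ∷ u) (i<x ∷ u>) i∈v =
    trans (SortedSuffix.suffixCount-¬∷ (unsorted-least i<x (∈-++⁺ʳ u i∈v))) (sortedCount-++ u u> i∈v)

  sorted-∷ : ∀ {x} → All (x ≤_) v → Sorted v → Sorted (x ∷ v)
  sorted-∷ x≤ s c d (_ ∷ʳ p)   = s c d p
  sorted-∷ x≤ s c d (refl ∷ p) = All.lookup x≤ (to∈ p)

  sorted-block : All (i <_) v → Sorted v → ∀ a → Sorted (Block.block i a v)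
  sorted-block v> s zero    = s
  sorted-block v> s (suc a) = sorted-∷ (Allₚ.++⁺ (Allₚ.replicate⁺ a ≤-refl) (All.map <⇒≤ v>)) (sorted-block v> s a)

  block-insert : All (i <_) u → All (i <_) v → Sorted v →
                 sortedCount (u ++ i ∷ Block.block i a v) ≡ suc (suc a) + length v
  block-insert {i} {u} {v} {a} u> v> s = trans (sortedCount-++ u u> (here refl))
    (trans (SortedSuffix.suffixCount-all (sorted-block v> s (suc a)))
    (cong (λ n → suc (suc n)) (trans (length-++ (replicate a i) {v}) (cong (_+ length v) (length-replicate a)))))

  scheme121 : Insertion.Scheme _≤_ _≤?_
  scheme121 = Block.scheme _≤_ _≤?_ (λ t a _ → suc (suc a) + t) block-insert

  -- A right part reaching into v descends to a trailing i. With `suc a` trailing copies, only the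
  -- `suc (suc a)` suffixes of their run, the empty one included, are sorted.
  qUnsorted : ℕ → ℕ → ℕ
  qUnsorted zero    q = q
  qUnsorted (suc a) _ = suc (suc a)

  -- In the first clause a nonempty v precedes trailing copies, as for `qUnsorted`. Otherwise v is
  -- empty or nothing trails, and the copies of i followed by v form a sorted word of length
  -- `suc a + t`.
  qSorted : ℕ → ℕ → ℕ → ℕ
  qSorted (suc t) (suc a) _ = suc (suc a)
  qSorted t       a       _ = suc (suc a) + t

  trailing-count : All (i <_) v → ∀ a → sortedCount (Trailing.trailing i (suc a) v) ≡ suc (suc a)
  trailing-count {i} {v} v> a = trans (sortedCount-++ v v> (here refl))
    (trans (cong sortedCount (sym (++-identityʳ (replicate (suc a) i)))) (trans (block-insert {a = a} [] [] λ _ _ ()) (+-identityʳ _)))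

  trailing-unsorted : ∀ a → All (i <_) v → sortedCount (Trailing.trailing i a v) ≡ qUnsorted a (sortedCount v)
  trailing-unsorted {v = v} zero v> = cong sortedCount (++-identityʳ v)
  trailing-unsorted (suc a)      v> = trailing-count v> a

  trailing-insert : ∀ v a → All (i <_) u → All (i <_) v → Sorted v →
                    sortedCount (u ++ i ∷ Trailing.trailing i a v) ≡ qSorted (length v) a (sortedCount (u ++ v))
  trailing-insert {i} {u} [] a u> [] s =
    trans (cong (λ t → sortedCount (u ++ i ∷ t)) (sym (++-identityʳ (replicate a i)))) (block-insert u> [] s)
  trailing-insert {i} {u} (x ∷ v) zero u> v> s =
    trans (cong (λ t → sortedCount (u ++ i ∷ t)) (++-identityʳ (x ∷ v))) (block-insert {a = 0} u> v> s)
  trailing-insert {i} {u} (x ∷ v) (suc a) u> v>@(i<x ∷ _) s = trans (sortedCount-++ u u> (here refl))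
    (trans (SortedSuffix.suffixCount-¬∷ λ s′ →
              unsorted-least i<x (∈-++⁺ʳ v (here refl)) (sorted-⊆ (i ∷ʳ ⊆-refl) s′))
           (trailing-count v> a))

  scheme112 : Insertion.Scheme _≤_ _≤?_
  scheme112 = Trailing.scheme _≤_ _≤?_ qUnsorted qSorted
    (λ {i} {a} v> _ → trailing-unsorted a v>) (λ {i} {a} {u} {v} → trailing-insert v a)

module WeaklyDecreasing where
  open Order _≥_ _≥?_

  sorted-trailing : ∀ a → All (i <_) u → Sorted u → Sorted (Trailing.trailing i a u)
  sorted-trailing a u> s c d p with i≤c ∷ i≤d ∷ [] ← All-resp-⊆ p (Trailing.trailing-≥ a u>) with m≤n⇒m<n∨m≡n i≤d
  ... | inj₂ refl = i≤c
  ... | inj₁ i<d with m≤n⇒m<n∨m≡n i≤c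
  ...   | inj₂ refl = contradiction p (Trailing.no-larger-after u> i<d a)
  ...   | inj₁ i<c  = s c d (⊆-trans (⊆-filter (i<c ∷ i<d ∷ []) p) (⊆-reflexive (Trailing.filter-trailing a u>)))

  trailing-count : ∀ a → All (i <_) u → sortedCount (Trailing.trailing i a u) ≡ sortedCount u + a
  trailing-count {i} {u} a u> = begin
    sortedCount (u ++ replicate a i)
      ≡⟨ count-splits-++ (sorted? ∘ proj₂) u (replicate a i) ⟩
    count (sorted? ∘ proj₂) (splitsBefore u (replicate a i)) + sortedCount (replicate a i)
      ≡⟨ cong₂ _+_ before (trans (SortedSuffix.suffixCount-all (sorted-trailing a [] λ _ _ ())) (cong suc (length-replicate a))) ⟩
    pre + (1 + a)
      ≡⟨ +-assoc pre 1 a ⟨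
    pre + 1 + a
      ≡⟨ cong (λ n → pre + n + a) (SortedSuffix.suffixCount-all {w = []} λ _ _ ()) ⟨
    pre + sortedCount [] + a
      ≡⟨ cong (_+ a) (count-splits-++ (sorted? ∘ proj₂) u []) ⟨
    sortedCount (u ++ []) + a
      ≡⟨ cong (λ w → sortedCount w + a) (++-identityʳ u) ⟩
    sortedCount u + a ∎
    where
    open ≡-Reasoning
    pre = count (sorted? ∘ proj₂) (splitsBefore u [])
    before : count (sorted? ∘ proj₂) (splitsBefore u (replicate a i)) ≡ pre
    before = countBefore-cong (sorted? ∘ proj₂) (sorted? ∘ proj₂) u λ u₁ x u₂ eq → mk⇔
      (sorted-⊆ (++⁺ (⊆-refl {x = x ∷ u₂}) (minimum _)))
      (λ s → sorted-trailing a (Allₚ.++⁻ʳ u₁ (subst (All (i <_)) (sym eq) u>)) (sorted-⊆ (++⁺ʳ [] ⊆-refl) s))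

  -- For empty v the copies of i end the word: they prolong every sorted right part and add `suc a`
  -- cuts. Otherwise i precedes a larger letter, an ascent, and only the suffixes of v, whose length
  -- is `suc t`, remain sorted.
  qSorted : ℕ → ℕ → ℕ → ℕ
  qSorted zero    a q = q + suc a
  qSorted (suc t) _ _ = suc (suc t)

  block-insert : ∀ v → All (i <_) u → All (i <_) v → Sorted v →
                 sortedCount (u ++ i ∷ Block.block i a v) ≡ qSorted (length v) a (sortedCount (u ++ v))
  block-insert {i} {u} {a} [] u> [] s =
    trans (cong (λ t → sortedCount (u ++ i ∷ t)) (++-identityʳ (replicate a i)))
    (trans (trailing-count (suc a) u>) (cong (λ w → sortedCount w + suc a) (sym (++-identityʳ u))))
  block-insert {i} {u} {a} (x ∷ v) u> (i<x ∷ _) s =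
    trans (SortedSuffix.suffixCount-¬ u (¬s a)) (trans (go (suc a)) (SortedSuffix.suffixCount-all s))
    where
    ¬s : ∀ a → ¬ Sorted (i ∷ Block.block i a (x ∷ v))
    ¬s a s′ = <⇒≱ i<x (s′ i x (refl ∷ ++⁺ˡ (replicate a i) (refl ∷ minimum v)))
    go : ∀ a → sortedCount (Block.block i a (x ∷ v)) ≡ sortedCount (x ∷ v)
    go zero    = refl
    go (suc a) = trans (SortedSuffix.suffixCount-¬∷ (¬s a)) (go a)

  scheme121 : Insertion.Scheme _≥_ _≥?_
  scheme121 = Block.scheme _≥_ _≥?_ qSorted (λ {i} {a} {u} {v} → block-insert v)

avoidsAll⇔ : ∀ {ρ₁ ρ₂} {P Q : Word → Set} → (∀ w → Avoids w ρ₁ ⇔ P w) → (∀ w → Avoids w ρ₂ ⇔ Q w) →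
             ∀ w → AvoidsAll (ρ₁ ∷ ρ₂ ∷ []) w ⇔ (P w × Q w)
avoidsAll⇔ e f w = mk⇔ (λ { (p ∷ q ∷ []) → Equivalence.to (e w) p , Equivalence.to (f w) q })
                       (λ (p , q) → Equivalence.from (e w) p ∷ Equivalence.from (f w) q ∷ [])

module _ {S : Rel} {S? : ∀ x y → Dec (S x y)} (sch : Insertion.Scheme S S?) where
  open Insertion S S?
  open Scheme sch using (Base)
  open Insert sch using (track12⊕; track21⊕)
  open Generation S S? sch

  12⊕∼21⊕ : ∀ {β ρ₁ ρ₂} → (∀ w → Avoids w β ⇔ Base w) →
            (∀ w → Avoids w ρ₁ ⇔ Avoids12⊕ S w) → (∀ w → Avoids w ρ₂ ⇔ Avoids21⊕ S w) →
            β ∷ ρ₁ ∷ [] ∼ β ∷ ρ₂ ∷ []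
  12⊕∼21⊕ base e₁ e₂ M =
    trans (av-states track12⊕ (avoidsAll⇔ base e₁) M) (sym (av-states track21⊕ (avoidsAll⇔ base e₂) M))

theorem2p19 : ((1 ∷ 2 ∷ 1 ∷ []) ∷ (1 ∷ 2 ∷ 4 ∷ 3 ∷ []) ∷ [] ∼ (1 ∷ 2 ∷ 1 ∷ []) ∷ (2 ∷ 1 ∷ 4 ∷ 3 ∷ []) ∷ [])
    × ((1 ∷ 1 ∷ 2 ∷ []) ∷ (1 ∷ 2 ∷ 4 ∷ 3 ∷ []) ∷ [] ∼ (1 ∷ 1 ∷ 2 ∷ []) ∷ (2 ∷ 1 ∷ 4 ∷ 3 ∷ []) ∷ [])
    × ((1 ∷ 2 ∷ 1 ∷ []) ∷ (1 ∷ 2 ∷ 3 ∷ 4 ∷ []) ∷ [] ∼ (1 ∷ 2 ∷ 1 ∷ []) ∷ (2 ∷ 1 ∷ 3 ∷ 4 ∷ []) ∷ [])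
theorem2p19 = 12⊕∼21⊕ WeaklyIncreasing.scheme121 avoids121⇔ avoids1243⇔ avoids2143⇔
            , 12⊕∼21⊕ WeaklyIncreasing.scheme112 avoids112⇔ avoids1243⇔ avoids2143⇔
            , 12⊕∼21⊕ WeaklyDecreasing.scheme121 avoids121⇔ avoids1234⇔ avoids2134⇔
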